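{- Let $(V,d)$ be a finite metric, $\{q_u\}_{u\in V}$ nonnegative vertex weights, $k$ an integer with $1\le k\le |V|$ and $t$ a positive integer. For $S\subseteq V$ let $\Phi(S)=\sum_{u\in V} q_u\, d(u,S) + d(\mathrm{MST}(V/S))$. Suppose $F\subseteq V$ with $|F|=k$ is a local optimum under $t$-swaps, i.e. there are no $D\subseteq F$ and $A\subseteq V\setminus F$ with $|D|=|A|\le t$ and $\Phi((F\setminus D)\cup A)<\Phi(F)$. Then for every $F^*\subseteq V$ with $|F^*|=k$, $$\Phi(F)\le \left(3+\tfrac{2}{t}\right)\Phi(F^*).$$
   Context: Here $d(u,S)=\min_{w\in S} d(u,w)$ and $d(\mathrm{MST}(V/S))$ denotes the total $d$-length of a minimum spanning tree of the complete graph on $V$ (edge lengths $d$) after contracting all vertices of $S$ into a single vertex.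
   Formalization: The distances d and the vertex weights q_u are taken to be rational numbers instead of real numbers. -}

module Defs where

open import Data.Nat as ℕ using (ℕ; zero; suc; _∸_)
open import Data.Fin using (Fin)
open import Data.Fin.Subset using (Subset; _∈_; _∉_; ∣_∣)
open import Data.Fin.Subset.Properties using (_∈?_)
open import Data.Rational using (ℚ; 0ℚ; _+_; _⊓_; _≤_)
open import Data.List using (List; []; _∷_; foldr; allFin; length)
open import Data.List.Membership.Propositional renaming (_∈_ to _∈ₗ_)
open import Data.Maybe using (Maybe; just; nothing; fromMaybe)
open import Data.Product using (_×_; _,_; Σ)
open import Data.Sum using (_⊎_)
open import Relation.Nullary using (¬_; yes; no)
open import Relation.Binary.PropositionalEquality using (_≡_; _≢_)

record IsMetric {n : ℕ} (d : Fin n → Fin n → ℚ) : Set where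
  field
    nonneg   : ∀ u v → 0ℚ ≤ d u v
    zero-iff : ∀ u v → d u v ≡ 0ℚ → u ≡ v
    refl0    : ∀ u → d u u ≡ 0ℚ
    sym      : ∀ u v → d u v ≡ d v u
    triangle : ∀ u v w → d u w ≤ d u v + d v w

-- d(u,S) = min_{w ∈ S} d(u,w)   (convention: 0 if S is empty; never used
-- in the theorem, where all sets have size k ≥ 1).
distToSet : {n : ℕ} → (Fin n → Fin n → ℚ) → Subset n → Fin n → ℚ
distToSet {n} d S u = fromMaybe 0ℚ (foldr step nothing (allFin n))
  where
  step : Fin n → Maybe ℚ → Maybe ℚ
  step w acc with w ∈? S
  ... | no _ = acc
  ... | yes _ with acc
  ...   | nothing = just (d u w)
  ...   | just m  = just (m ⊓ d u w)

serviceCost : {n : ℕ} → (Fin n → Fin n → ℚ) → (Fin n → ℚ) → Subset n → ℚ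
serviceCost {n} d q S = foldr (λ u acc → q u * distToSet d S u + acc) 0ℚ (allFin n)
  where open Data.Rational using (_*_)

edgeWeight : {n : ℕ} → (Fin n → Fin n → ℚ) → List (Fin n × Fin n) → ℚ
edgeWeight d = foldr (λ { (u , v) acc → d u v + acc }) 0ℚ

-- Connectivity in the graph V/S with edge set T: all vertices of S are
-- identified (contracted), and T-edges can be traversed in either direction.
data Conn {n : ℕ} (S : Subset n) (T : List (Fin n × Fin n)) : Fin n → Fin n → Set where
  here : ∀ {u} → Conn S T u u
  viaS : ∀ {u w v} → u ∈ S → w ∈ S → Conn S T w v → Conn S T u v
  viaE : ∀ {u w v} → ((u , w) ∈ₗ T ⊎ (w , u) ∈ₗ T) → Conn S T w v → Conn S T u v

-- T is a spanning tree of the complete graph on V after contracting S into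
-- one vertex.  V/S has (n - |S|) + 1 vertices (S nonempty), so a spanning
-- tree is a connected spanning edge set with n - |S| edges.  Edges are
-- edges of V/S: no loops, i.e. not both endpoints in S and distinct ends.
record IsSpanningTreeContr {n : ℕ} (S : Subset n) (T : List (Fin n × Fin n)) : Set where
  field
    edgesOk   : ∀ u v → (u , v) ∈ₗ T → u ≢ v × ¬ (u ∈ S × v ∈ S)
    size      : length T ≡ n ∸ ∣ S ∣
    connected : ∀ u v → Conn S T u v

IsMSTWeight : {n : ℕ} → (Fin n → Fin n → ℚ) → Subset n → ℚ → Set
IsMSTWeight {n} d S m =
  Σ (List (Fin n × Fin n)) (λ T → IsSpanningTreeContr S T × edgeWeight d T ≡ m)
  × (∀ T → IsSpanningTreeContr S T → m ≤ edgeWeight d T)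

IsPhi : {n : ℕ} → (Fin n → Fin n → ℚ) → (Fin n → ℚ) → Subset n → ℚ → Set
IsPhi d q S φ = Σ ℚ (λ m → IsMSTWeight d S m × φ ≡ serviceCost d q S + m)

{-# OPTIONS --safe #-}
module Submission where

open import Defs
open import Data.Fin as Fin using (Fin; suc)
open import Data.Fin.Subset using (Subset; _⊆_; _∈_; _∉_; _∪_; _∩_; ∁; ∣_∣; inside; outside)
open import Data.Fin.Subset.Properties using (_∈?_; x∈∁p⇒x∉p; x∉p⇒x∈∁p; ∣∁p∣≡n∸∣p∣; drop-there; x∈p∩q⁺; x∈p∪q⁺)
open import Data.Integer using (+_)
import Data.Integer.Solver as ℤ
open import Data.List using (List; []; _∷_; foldr; allFin; length; map; filter; _++_; tabulate; cartesianProductWith)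
open import Data.List.Membership.Propositional using (lose) renaming (_∈_ to _∈ₗ_; _∉_ to _∉ₗ_)
open import Data.List.Membership.Propositional.Properties using (∈-allFin; ∈-map⁺; ∈-map⁻; ∈-filter⁺; ∈-filter⁻; ∈-++⁺ˡ; ∈-++⁺ʳ; ∈-++⁻; ∈-cartesianProductWith⁺)
open import Data.List.Membership.Propositional.Properties.WithK using (unique∧set⇒bag)
open import Data.List.Properties using (length-map; filter-accept; filter-reject)
open import Data.List.Relation.Binary.BagAndSetEquality using (∼bag⇒↭)
open import Data.List.Relation.Binary.Permutation.Propositional.Properties using (↭-length)
open import Data.List.Relation.Unary.All as All using (All; []; _∷_)
open import Data.List.Relation.Unary.All.Properties using (All¬⇒¬Any)
open import Data.List.Relation.Unary.Any using (Any; here; there; any?)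
open import Data.List.Relation.Unary.Unique.Propositional using (Unique; []; _∷_)
open import Data.List.Relation.Unary.Unique.Propositional.Properties using (allFin⁺; filter⁺)
open import Data.Maybe using (Maybe; just; nothing; fromMaybe)
open import Data.Maybe.Properties using (just-injective)
open import Data.Nat as ℕ using (ℕ; zero; suc; NonZero; _∸_) renaming (_≤_ to _≤ℕ_)
open import Data.Nat.ListAction using (sum)
import Data.Nat.Properties as ℕ
open import Data.Product using (_×_; _,_; Σ; ∃; proj₁; proj₂)
open import Data.Rational using (ℚ; 0ℚ; 1ℚ; toℚᵘ; _≤_; _<_; _⊓_; _+_; _*_; _-_; -_; _/_; nonNegative)
open import Data.Rational.Properties hiding (_≟_)
open import Data.Rational.Solver using (module +-*-Solver)
open import Data.Rational.Unnormalised as ℚᵘ using (mkℚᵘ; *≡*)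
import Data.Rational.Unnormalised.Properties as ℚᵘ
open import Data.Sum using (_⊎_; inj₁; inj₂; map₂)
open import Data.Vec as Vec using ([]; _∷_)
open import Data.Vec.Properties using (lookup∘tabulate; lookup⇒[]=; []=⇒lookup)
open import Function using (_∘_; id; case_of_)
open import Function.Bundles using (mk⇔)
open import Relation.Nullary using (¬_; Dec; yes; no; contradiction; ¬?; _×-dec_; _⊎-dec_)
open import Relation.Nullary.Decidable using (does; dec-true; decidable-stable)
open import Relation.Binary.PropositionalEquality using (_≡_; _≢_; refl; sym; trans; cong; cong₂; subst; subst₂; module ≡-Reasoning)
open +-*-Solver using (solve; _:+_; _:*_; _:=_; :-_; _:-_; con)

-- Root the minimum spanning trees T of V/F and T* of V/F*, so that every vertex pays for the edge to its parent, and let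
-- η x be the centre of F nearest to x ∈ F*. Consider a swap (D , A) such that η x ∈ D implies x ∈ A. Clients
-- served by A in the optimum move there and the others avoid D through η, as for k-median. For the trees, the components
-- of T* rooted in A use T*, all other vertices keep their edge of T, and each deleted centre is linked to the next
-- centre of F on a closed tour of its component of T*, the last one to η of the root; the tours cost at most twice T*.
-- So each new centre x contributes a gain G x, each deleted centre f a penalty P f, and G x summed over F* is the
-- optimum minus Φ(F) while P f summed over F is at most twice the optimum. Local optimality makes
-- every swap's balance nonnegative, and combining swaps that use each x ∈ F* once and each f ∈ F
-- with weight at most 1 + 1/t gives Φ(F) ≤ Φ(F*) + 2 (1 + 1/t) Φ(F*).

-- A swapped tree draws its edges from three sources, which could close cycles. They do not, because
-- the components of T* are closed under its parent map and a tour stays inside one component. A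
-- path follows T until it meets F or a component rooted in A. In the latter case it ends at an
-- added centre. In the former it runs along the tour of a component whose root is not added, up to
-- η of that root, which the condition on (D , A) keeps.
--
-- The weight 1 + 1/t has this origin. As F and F* have equal size, every centre f hit by η can be
-- given private unhit centres, one fewer than its fibre has elements. A group of size at most t is
-- one swap. In a larger one f is kept, all new centres but one are paired with unhit ones, and the
-- last is paired with t of these at weight 1/t each. A centre f common to F and F* lies in its own
-- fibre and is kept as well.
--
-- Local optimality speaks only of sets whose tree weight is given, and a minimum tree of the
-- swapped set is obtained only under double negation. That is enough, since the balance of a swap
-- is a comparison of rationals, which is decidable.

private variable
  A B : Set

-- Linear arithmetic by certificate: `l ≤ r` is a sum of known inequalities, and the identity says
-- that `b - a` is exactly its slack, which the ring solver can check.
≤-by-excess : ∀ {a b l r} → l ≤ r → a + r ≡ b + l → a ≤ b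
≤-by-excess {a} {b} {l} {r} l≤r eq = begin
  a             ≡⟨ solve 2 (λ a r → a := (a :+ r) :- r) refl a r ⟩
  (a + r) - r   ≡⟨ cong (_- r) eq ⟩
  (b + l) - r   ≤⟨ +-monoˡ-≤ (- r) (+-monoʳ-≤ b l≤r) ⟩
  (b + r) - r   ≡⟨ solve 2 (λ b r → (b :+ r) :- r := b) refl b r ⟩
  b             ∎
  where open ≤-Reasoning

+-nonneg : ∀ {a b} → 0ℚ ≤ a → 0ℚ ≤ b → 0ℚ ≤ a + b
+-nonneg {a} {b} 0≤a 0≤b = +-mono-≤ {0ℚ} {a} {0ℚ} {b} 0≤a 0≤b

*-nonneg : ∀ {a b} → 0ℚ ≤ a → 0ℚ ≤ b → 0ℚ ≤ a * b
*-nonneg {a} {b} 0≤a 0≤b =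
  subst (_≤ a * b) (*-zeroʳ a) (*-monoˡ-≤-nonNeg a {{nonNegative 0≤a}} 0≤b)

a≤a+b : ∀ {a b} → 0ℚ ≤ b → a ≤ a + b
a≤a+b {a} {b} 0≤b = subst (_≤ a + b) (+-identityʳ a) (+-monoʳ-≤ a 0≤b)

a≤b+a : ∀ {a b} → 0ℚ ≤ b → a ≤ b + a
a≤b+a {a} {b} 0≤b = subst (_≤ b + a) (+-identityˡ a) (+-monoˡ-≤ a 0≤b)

-- Conditional summands and finite sums

if-dec : {P : Set} → Dec P → ℚ → ℚ
if-dec (yes _) x = x
if-dec (no _)  x = 0ℚ

if-yes : {P : Set} (p? : Dec P) {x : ℚ} → P → if-dec p? x ≡ x
if-yes (yes _) _ = refl
if-yes (no ¬p) p = contradiction p ¬p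

if-no : {P : Set} (p? : Dec P) {x : ℚ} → ¬ P → if-dec p? x ≡ 0ℚ
if-no (yes p) ¬p = contradiction p ¬p
if-no (no _)  _  = refl

if-nonneg : {P : Set} (p? : Dec P) {x : ℚ} → 0ℚ ≤ x → 0ℚ ≤ if-dec p? x
if-nonneg (yes _) 0≤x = 0≤x
if-nonneg (no _)  _   = ≤-refl

if-≤ : {P : Set} (p? : Dec P) {x : ℚ} → 0ℚ ≤ x → if-dec p? x ≤ x
if-≤ (yes _) _   = ≤-refl
if-≤ (no _)  0≤x = 0≤x

sumOver : List A → (A → ℚ) → ℚ
sumOver xs f = foldr (λ u acc → f u + acc) 0ℚ xs

sum-mono : ∀ (xs : List A) {f g : A → ℚ} → (∀ {u} → u ∈ₗ xs → f u ≤ g u) → sumOver xs f ≤ sumOver xs g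
sum-mono []       f≤g = ≤-refl
sum-mono (x ∷ xs) f≤g = +-mono-≤ (f≤g (here refl)) (sum-mono xs (f≤g ∘ there))

sum-cong : ∀ (xs : List A) {f g : A → ℚ} → (∀ {u} → u ∈ₗ xs → f u ≡ g u) → sumOver xs f ≡ sumOver xs g
sum-cong []       f≡g = refl
sum-cong (x ∷ xs) f≡g = cong₂ _+_ (f≡g (here refl)) (sum-cong xs (f≡g ∘ there))

sum-zero : ∀ (xs : List A) {f : A → ℚ} → (∀ {u} → u ∈ₗ xs → f u ≡ 0ℚ) → sumOver xs f ≡ 0ℚ
sum-zero []       f≡0 = refl
sum-zero (x ∷ xs) f≡0 = cong₂ _+_ (f≡0 (here refl)) (sum-zero xs (f≡0 ∘ there))

sum-nonneg : ∀ (xs : List A) {f : A → ℚ} → (∀ {u} → u ∈ₗ xs → 0ℚ ≤ f u) → 0ℚ ≤ sumOver xs f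
sum-nonneg []       0≤f = ≤-refl
sum-nonneg (x ∷ xs) 0≤f = +-nonneg (0≤f (here refl)) (sum-nonneg xs (0≤f ∘ there))

sum-+ : ∀ (xs : List A) (f g : A → ℚ) → sumOver xs (λ u → f u + g u) ≡ sumOver xs f + sumOver xs g
sum-+ []       f g = refl
sum-+ (x ∷ xs) f g = trans (cong (_+_ (f x + g x)) (sum-+ xs f g))
  (solve 4 (λ a b c e → (a :+ b) :+ (c :+ e) := (a :+ c) :+ (b :+ e)) refl
    (f x) (g x) (sumOver xs f) (sumOver xs g))

sum-neg : ∀ (xs : List A) (f : A → ℚ) → sumOver xs (λ u → - f u) ≡ - sumOver xs f
sum-neg []       f = refl
sum-neg (x ∷ xs) f = trans (cong (_+_ (- f x)) (sum-neg xs f)) (sym (neg-distrib-+ (f x) _))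

sum-++ : ∀ (xs ys : List A) (f : A → ℚ) → sumOver (xs ++ ys) f ≡ sumOver xs f + sumOver ys f
sum-++ []       ys f = sym (+-identityˡ _)
sum-++ (x ∷ xs) ys f = trans (cong (_+_ (f x)) (sum-++ xs ys f)) (sym (+-assoc (f x) _ _))

sum-swap : ∀ (xs : List A) (ys : List B) (f : A → B → ℚ) →
  sumOver xs (λ x → sumOver ys (f x)) ≡ sumOver ys (λ y → sumOver xs (λ x → f x y))
sum-swap []       ys f = sym (sum-zero ys (λ _ → refl))
sum-swap (x ∷ xs) ys f = trans (cong (_+_ (sumOver ys (f x))) (sum-swap xs ys f))
  (sym (sum-+ ys (f x) (λ y → sumOver xs (λ x → f x y))))

module _ {n : ℕ} where

  private
    V = Fin n

  open import Data.List.Membership.DecPropositional (Fin._≟_ {n}) public using () renaming (_∈?_ to _∈ₗ?_)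

  if-point : ∀ (xs : List V) → Unique xs → (h : V) {x : ℚ} →
    sumOver xs (λ a → if-dec (h Fin.≟ a) x) ≡ if-dec (h ∈ₗ? xs) x
  if-point []       _          h = refl
  if-point (a ∷ xs) (a∉ ∷ uxs) h {x} with h Fin.≟ a | h ∈ₗ? xs | if-point xs uxs h {x}
  ... | yes refl | yes h∈ | _  = contradiction h∈ (All¬⇒¬Any a∉)
  ... | yes refl | no _   | eq = trans (cong (_+_ x) eq) (+-identityʳ x)
  ... | no _     | yes _  | eq = trans (cong (_+_ 0ℚ) eq) (+-identityˡ x)
  ... | no _     | no _   | eq = trans (cong (_+_ 0ℚ) eq) (+-identityˡ 0ℚ)

  sum-point≤ : ∀ (xs : List V) → Unique xs → ∀ a {x} → 0ℚ ≤ x →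
    sumOver xs (λ v → if-dec (v Fin.≟ a) x) ≤ x
  sum-point≤ []       _          a 0≤x = 0≤x
  sum-point≤ (v ∷ xs) (v∉ ∷ uxs) a {x} 0≤x with v Fin.≟ a
  ... | no _     = ≤-trans (≤-reflexive (+-identityˡ _)) (sum-point≤ xs uxs a 0≤x)
  ... | yes refl = ≤-reflexive (trans (cong (_+_ x) (sum-zero xs λ {w} w∈ → if-no (w Fin.≟ v) λ { refl → All¬⇒¬Any v∉ w∈ }))
                                      (+-identityʳ x))

  allV : List V
  allV = allFin n

  sum-classes : ∀ (xs : List V) → Unique xs → (h : V → V) (g : V → ℚ) →
    sumOver xs (λ a → sumOver allV (λ u → if-dec (h u Fin.≟ a) (g u)))
    ≡ sumOver allV (λ u → if-dec (h u ∈ₗ? xs) (g u))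
  sum-classes xs uxs h g = trans (sum-swap xs allV (λ a u → if-dec (h u Fin.≟ a) (g u))) (sum-cong allV (λ {u} _ → if-point xs uxs (h u)))

-- Rooted forests

-- Being inductive, this certifies that parent pointers do not cycle before meeting `S`. It works
-- for any parent map, in particular for one pieced together from several forests.
data Reach {n} (S : Subset n) (par : Fin n → Fin n) : Fin n → Set where
  root : ∀ {u} → u ∈ S → Reach S par u
  step : ∀ {u} → Reach S par (par u) → Reach S par u

module _ {n : ℕ} (S : Subset n) where

  private
    V = Fin n

  -- A fixed point outside `S` would need an infinite derivation. This excludes loops among the
  -- edges `(u , par u)`.
  reach-moves : ∀ {par : V → V} {u} → Reach S par u → u ∉ S → u ≢ par u
  reach-moves (root u∈S) u∉S _  = u∉S u∈S
  reach-moves {par} (step r) u∉S eq = reach-moves r (subst (_∉ S) eq u∉S) (cong par eq)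

  data Covered (es : List (V × V)) (u : V) : Set where
    base  : u ∈ S → Covered es u
    added : u ∈ₗ map proj₁ es → Covered es u

  covered? : ∀ es u → Dec (Covered es u)
  covered? es u with u ∈? S | u ∈ₗ? map proj₁ es
  ... | yes u∈S | _        = yes (base u∈S)
  ... | no _    | yes u∈es = yes (added u∈es)
  ... | no u∉S  | no u∉es  = no λ { (base u∈S) → u∉S u∈S ; (added u∈es) → u∉es u∈es }

  -- Forests rooted in S, as lists of edges (child , parent) with the last vertex added, a leaf, first.
  data Grown : List (V × V) → Set where
    []   : Grown []
    grow : ∀ {u p es} → ¬ Covered es u → Covered es p → Grown es → Grown ((u , p) ∷ es)

  -- The default makes roots their own parents, an edge of length 0.
  parent : List (V × V) → V → V
  parent []             u = u
  parent ((v , p) ∷ es) u with u Fin.≟ v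
  ... | yes _ = p
  ... | no  _ = parent es u

  -- In a `Grown` list the parent `p` was covered before `v` was added, so its root is already
  -- determined by `es`.
  rootOf : List (V × V) → V → V
  rootOf []             u = u
  rootOf ((v , p) ∷ es) u with u Fin.≟ v
  ... | yes _ = rootOf es p
  ... | no  _ = rootOf es u

  rootOf-old : ∀ {v p es u} → ¬ Covered es v → Covered es u → rootOf ((v , p) ∷ es) u ≡ rootOf es u
  rootOf-old {v} {u = u} v∉ u∈ with u Fin.≟ v
  ... | yes refl = contradiction u∈ v∉
  ... | no _     = refl

  rootOf-new : ∀ v p es → rootOf ((v , p) ∷ es) v ≡ rootOf es p
  rootOf-new v p es with v Fin.≟ v
  ... | yes _  = refl
  ... | no v≢v = contradiction refl v≢v

  covered-weaken : ∀ {e es u} → Covered es u → Covered (e ∷ es) u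
  covered-weaken (base u∈S)   = base u∈S
  covered-weaken (added u∈es) = added (there u∈es)

  covered-tail : ∀ {v p es u} → Covered ((v , p) ∷ es) u → u ≢ v → Covered es u
  covered-tail (base u∈S)          _   = base u∈S
  covered-tail (added (here u≡v))   u≢v = contradiction u≡v u≢v
  covered-tail (added (there u∈es)) _   = added u∈es

  parent-covered : ∀ {es u} → Grown es → Covered es u → Covered es (parent es u)
  parent-covered {[]}             []               u∈ = u∈
  parent-covered {(v , p) ∷ es} {u} (grow v∉ p∈ g) u∈ with u Fin.≟ v
  ... | yes _  = covered-weaken p∈
  ... | no u≢v = covered-weaken (parent-covered g (covered-tail u∈ u≢v))

  rootOf-self : ∀ {es u} → Grown es → u ∈ S → rootOf es u ≡ u
  rootOf-self []             u∈S = refl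
  rootOf-self (grow v∉ _ g) u∈S = trans (rootOf-old v∉ (base u∈S)) (rootOf-self g u∈S)

  rootOf∈ : ∀ {es u} → Grown es → Covered es u → rootOf es u ∈ S
  rootOf∈ []               (base u∈S) = u∈S
  rootOf∈ {(v , p) ∷ es} {u} (grow v∉ p∈ g) u∈ with u Fin.≟ v
  ... | yes _  = rootOf∈ g p∈
  ... | no u≢v = rootOf∈ g (covered-tail u∈ u≢v)

  rootOf-parent : ∀ {es u} → Grown es → Covered es u → rootOf es (parent es u) ≡ rootOf es u
  rootOf-parent []               u∈ = refl
  rootOf-parent {(v , p) ∷ es} {u} (grow v∉ p∈ g) u∈ with u Fin.≟ v
  ... | yes refl = rootOf-old v∉ p∈
  ... | no u≢v   = trans (rootOf-old v∉ (parent-covered g u∈es)) (rootOf-parent g u∈es)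
    where u∈es = covered-tail u∈ u≢v

  rootOf-edges : ∀ {es} → Grown es → All (λ e → rootOf es (proj₂ e) ≡ rootOf es (proj₁ e)) es
  rootOf-edges [] = []
  rootOf-edges {(v , p) ∷ es} (grow v∉ p∈ g) =
    trans (rootOf-old v∉ p∈) (sym (rootOf-new v p es)) ∷ All.tabulate later
    where
    ends-covered : ∀ {es} → Grown es → All (λ e → Covered es (proj₁ e) × Covered es (proj₂ e)) es
    ends-covered []             = []
    ends-covered (grow _ p∈ g) = (added (here refl) , covered-weaken p∈)
      ∷ All.map (λ (c₁ , c₂) → covered-weaken c₁ , covered-weaken c₂) (ends-covered g)
    later : ∀ {e} → e ∈ₗ es → rootOf ((v , p) ∷ es) (proj₂ e) ≡ rootOf ((v , p) ∷ es) (proj₁ e)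
    later e∈ with All.lookup (ends-covered g) e∈
    ... | c₁ , c₂ = trans (rootOf-old v∉ c₂) (trans (All.lookup (rootOf-edges g) e∈) (sym (rootOf-old v∉ c₁)))

  parent-old : ∀ {v p es u} → u ≢ v → parent ((v , p) ∷ es) u ≡ parent es u
  parent-old {v} {u = u} u≢v with u Fin.≟ v
  ... | yes u≡v = contradiction u≡v u≢v
  ... | no _    = refl

  parent-new : ∀ v p es → parent ((v , p) ∷ es) v ≡ p
  parent-new v p es with v Fin.≟ v
  ... | yes _  = refl
  ... | no v≢v = contradiction refl v≢v

  reach-weaken : ∀ {v p es u} → ¬ Covered es v → Grown es → Covered es u →
    Reach S (parent es) u → Reach S (parent ((v , p) ∷ es)) u
  reach-weaken v∉ g u∈ (root u∈S)         = root u∈S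
  reach-weaken {es = es} v∉ g u∈ (step r) = step (subst (Reach S _) (sym (parent-old {es = es} (λ { refl → v∉ u∈ })))
    (reach-weaken v∉ g (parent-covered g u∈) r))

  parent-reach : ∀ {es u} → Grown es → Covered es u → Reach S (parent es) u
  parent-reach []                                  (base u∈S) = root u∈S
  parent-reach {(v , p) ∷ es} {u} (grow v∉ p∈ g) u∈ with u Fin.≟ v
  ... | no u≢v   = reach-weaken v∉ g u∈es (parent-reach g u∈es)
    where u∈es = covered-tail u∈ u≢v
  ... | yes refl = step (subst (Reach S _) (sym (parent-new v p es)) (reach-weaken v∉ g p∈ (parent-reach g p∈)))

-- Edge costs charged to the children

module _ {n : ℕ} {d : Fin n → Fin n → ℚ} (metric : IsMetric d) where

  private
    V = Fin n
    open IsMetric metric renaming (sym to d-sym)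

  linkCost : Subset n → (V → V) → V → ℚ
  linkCost S par u with u ∈? S
  ... | yes _ = 0ℚ
  ... | no  _ = d u (par u)

  linkCost-∈ : ∀ {S par u} → u ∈ S → linkCost S par u ≡ 0ℚ
  linkCost-∈ {S} {u = u} u∈ with u ∈? S
  ... | yes _ = refl
  ... | no u∉ = contradiction u∈ u∉

  linkCost-∉ : ∀ {S par u} → u ∉ S → linkCost S par u ≡ d u (par u)
  linkCost-∉ {S} {u = u} u∉ with u ∈? S
  ... | yes u∈ = contradiction u∈ u∉
  ... | no _   = refl

  linkCost-nonneg : ∀ S par u → 0ℚ ≤ linkCost S par u
  linkCost-nonneg S par u with u ∈? S
  ... | yes _ = ≤-refl
  ... | no _  = nonneg u (par u)

  edgeWeight-nonneg : ∀ es → 0ℚ ≤ edgeWeight d es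
  edgeWeight-nonneg []             = ≤-refl
  edgeWeight-nonneg ((u , v) ∷ es) = +-nonneg (nonneg u v) (edgeWeight-nonneg es)

  -- An additional edge changes the parent of its child only, so a single summand changes, and it
  -- grows by at most the length of that edge.
  sum-linkCost : ∀ S es → Unique (allV {n}) → sumOver allV (linkCost S (parent S es)) ≤ edgeWeight d es
  sum-linkCost S []             _  = ≤-reflexive (sum-zero allV (λ {u} _ → eq u))
    where
    eq : ∀ u → linkCost S (parent S []) u ≡ 0ℚ
    eq u with u ∈? S
    ... | yes _ = refl
    ... | no _  = refl0 u
  sum-linkCost S ((v , p) ∷ es) uV = begin
    sumOver allV (linkCost S (parent S ((v , p) ∷ es)))
      ≤⟨ sum-mono allV (λ {u} _ → bound u) ⟩
    sumOver allV (λ u → if-dec (u Fin.≟ v) (d v p) + linkCost S (parent S es) u)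
      ≡⟨ sum-+ allV (λ u → if-dec (u Fin.≟ v) (d v p)) (linkCost S (parent S es)) ⟩
    sumOver allV (λ u → if-dec (u Fin.≟ v) (d v p)) + sumOver allV (linkCost S (parent S es))
      ≤⟨ +-mono-≤ (sum-point≤ allV uV v (nonneg v p)) (sum-linkCost S es uV) ⟩
    d v p + edgeWeight d es ∎
    where
    open ≤-Reasoning
    bound : ∀ u → linkCost S (parent S ((v , p) ∷ es)) u ≤ if-dec (u Fin.≟ v) (d v p) + linkCost S (parent S es) u
    bound u = by-cases (u ∈? S) (u Fin.≟ v)
      where
      by-cases : Dec (u ∈ S) → (u≟v : Dec (u ≡ v)) →
        linkCost S (parent S ((v , p) ∷ es)) u ≤ if-dec u≟v (d v p) + linkCost S (parent S es) u
      by-cases (yes u∈S) u≟v        = subst (_≤ if-dec u≟v (d v p) + linkCost S (parent S es) u)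
        (sym (linkCost-∈ u∈S))
        (+-nonneg (if-nonneg u≟v (nonneg v p)) (linkCost-nonneg S (parent S es) u))
      by-cases (no u∉S)  (yes refl) = subst (_≤ d v p + linkCost S (parent S es) v)
        (sym (trans (linkCost-∉ u∉S) (cong (d v) (parent-new S v p es))))
        (a≤a+b (linkCost-nonneg S (parent S es) v))
      by-cases (no u∉S)  (no u≢v)   = ≤-reflexive (begin-equality
        linkCost S (parent S ((v , p) ∷ es)) u ≡⟨ linkCost-∉ u∉S ⟩
        d u (parent S ((v , p) ∷ es) u)        ≡⟨ cong (d u) (parent-old S u≢v) ⟩
        d u (parent S es u)                    ≡⟨ linkCost-∉ u∉S ⟨
        linkCost S (parent S es) u             ≡⟨ +-identityˡ _ ⟨
        0ℚ + linkCost S (parent S es) u        ∎)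

-- Connectivity, and subsets as duplicate-free lists

conn-trans : ∀ {n} {S : Subset n} {T u v w} → Conn S T u v → Conn S T v w → Conn S T u w
conn-trans here           c′ = c′
conn-trans (viaS u∈ w∈ c) c′ = viaS u∈ w∈ (conn-trans c c′)
conn-trans (viaE e∈ c)    c′ = viaE e∈ (conn-trans c c′)

conn-sym : ∀ {n} {S : Subset n} {T u v} → Conn S T u v → Conn S T v u
conn-sym here                  = here
conn-sym (viaS u∈ w∈ c)        = conn-trans (conn-sym c) (viaS w∈ u∈ here)
conn-sym (viaE (inj₁ uw∈) c)   = conn-trans (conn-sym c) (viaE (inj₂ uw∈) here)
conn-sym (viaE (inj₂ wu∈) c)   = conn-trans (conn-sym c) (viaE (inj₁ wu∈) here)

members : ∀ {n} → Subset n → List (Fin n)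
members S = filter (_∈? S) allV

∈-members⁺ : ∀ {n} {S : Subset n} {u} → u ∈ S → u ∈ₗ members S
∈-members⁺ {S = S} u∈ = ∈-filter⁺ (_∈? S) (∈-allFin _) u∈

∈-members⁻ : ∀ {n} {S : Subset n} {u} → u ∈ₗ members S → u ∈ S
∈-members⁻ {S = S} u∈ = proj₂ (∈-filter⁻ (_∈? S) {xs = allV} u∈)

members-unique : ∀ {n} (S : Subset n) → Unique (members S)
members-unique S = filter⁺ (_∈? S) (allFin⁺ _)

length-filter-tabulate : ∀ {n} {A : Set} {P : A → Set} (P? : ∀ x → Dec (P x)) (S : Subset n) (f : Fin n → A) →
  (∀ {i} → i ∈ S → P (f i)) → (∀ {i} → P (f i) → i ∈ S) → length (filter P? (tabulate f)) ≡ ∣ S ∣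
length-filter-tabulate P? []            f to from = refl
length-filter-tabulate P? (inside  ∷ S) f to from = trans
  (cong length (filter-accept P? (to Vec.here)))
  (cong suc (length-filter-tabulate P? S (f ∘ suc) (to ∘ Vec.there) (drop-there ∘ from)))
length-filter-tabulate P? (outside ∷ S) f to from = trans
  (cong length (filter-reject P? (λ Pf → case from Pf of λ ())))
  (length-filter-tabulate P? S (f ∘ suc) (to ∘ Vec.there) (drop-there ∘ from))

length-members : ∀ {n} (S : Subset n) → length (members S) ≡ ∣ S ∣
length-members S = length-filter-tabulate (_∈? S) S id id id

sum-filter : ∀ {n} {P : Fin n → Set} (P? : ∀ x → Dec (P x)) (xs : List (Fin n)) (f : Fin n → ℚ) →
  sumOver (filter P? xs) f ≡ sumOver xs (λ u → if-dec (P? u) (f u))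
sum-filter P? []       f = refl
sum-filter P? (x ∷ xs) f with P? x
... | yes _ = cong (_+_ (f x)) (sum-filter P? xs f)
... | no _  = trans (sum-filter P? xs f) (sym (+-identityˡ _))

-- Passing between spanning trees and rooted forests

module _ {n : ℕ} {d : Fin n → Fin n → ℚ} (metric : IsMetric d) where

  private
    V = Fin n
    open IsMetric metric renaming (sym to d-sym)

  -- Prim's algorithm restricted to the edges of T; rest holds the edges not yet used.
  grow-within : ∀ {S T} → ∃ (_∈ S) → (∀ u v → Conn S T u v) →
    ∃ λ es → Grown S es × (∀ u → Covered S es u) × edgeWeight d es ≤ edgeWeight d T
  grow-within {S} {T} (s , s∈S) conn =
    extend (length T) T [] refl [] inj₁ (≤-reflexive (+-identityˡ _))
    where
    Both Crosses : List (V × V) → V × V → Set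
    Both    es (x , y) = Covered S es x × Covered S es y
    Crosses es (x , y) = (¬ Covered S es x × Covered S es y) ⊎ (¬ Covered S es y × Covered S es x)

    crosses? : ∀ es e → Dec (Crosses es e)
    crosses? es (x , y) = (¬? (covered? S es x) ×-dec covered? S es y) ⊎-dec (¬? (covered? S es y) ×-dec covered? S es x)

    extract : ∀ {P : V × V → Set} {es} → Any P es → Σ (V × V) λ e → ∃ λ es′ → P e
      × length es ≡ suc (length es′) × edgeWeight d es ≡ d (proj₁ e) (proj₂ e) + edgeWeight d es′
      × (∀ {e′} → e′ ∈ₗ es → e′ ≡ e ⊎ e′ ∈ₗ es′)
    extract {es = e ∷ es} (here Pe)  = e , es , Pe , refl , refl , λ { (here refl) → inj₁ refl ; (there e∈) → inj₂ e∈ }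
    extract {es = e ∷ es} (there P∈) with extract P∈
    ... | (u , v) , es′ , Pe , len , weight , locate = (u , v) , e ∷ es′ , Pe , cong suc len ,
      trans (cong (_+_ (d (proj₁ e) (proj₂ e))) weight)
        (solve 3 (λ a b c → a :+ (b :+ c) := b :+ (a :+ c)) refl (d (proj₁ e) (proj₂ e)) (d u v) (edgeWeight d es′)) ,
      λ { (here refl) → inj₂ (here refl) ; (there e∈) → map₂ there (locate e∈) }

    pick : ∀ {es rest} → Any (Crosses es) rest → ∃ λ u → ∃ λ p → ∃ λ rest′ → ¬ Covered S es u × Covered S es p
      × length rest ≡ suc (length rest′) × edgeWeight d rest ≡ d u p + edgeWeight d rest′
      × (∀ {e} → e ∈ₗ rest → e ∈ₗ rest′ ⊎ Both ((u , p) ∷ es) e)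
    pick crossing with extract crossing
    ... | (x , y) , rest′ , inj₁ (x∉ , y∈) , len , weight , locate = x , y , rest′ , x∉ , y∈ , len , weight ,
      λ e∈ → case locate e∈ of λ { (inj₁ refl) → inj₂ (added (here refl) , covered-weaken S y∈) ; (inj₂ e∈′) → inj₁ e∈′ }
    ... | (x , y) , rest′ , inj₂ (y∉ , x∈) , len , weight , locate = y , x , rest′ , y∉ , x∈ , len ,
      trans weight (cong (_+ edgeWeight d rest′) (d-sym x y)) ,
      λ e∈ → case locate e∈ of λ { (inj₁ refl) → inj₂ (covered-weaken S x∈ , added (here refl)) ; (inj₂ e∈′) → inj₁ e∈′ }

    -- `m` is the termination measure, since every picked edge leaves `rest`. The invariant keeps
    -- each edge of `T` either available or with both ends already covered.
    extend : ∀ m rest es → length rest ≡ m → Grown S es → (∀ {e} → e ∈ₗ T → e ∈ₗ rest ⊎ Both es e) →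
      edgeWeight d es + edgeWeight d rest ≤ edgeWeight d T →
      ∃ λ es → Grown S es × (∀ u → Covered S es u) × edgeWeight d es ≤ edgeWeight d T
    extend m rest es len g track weight with any? (crosses? es) rest
    -- No edge of `T` leaves the covered set any more: an available one does not cross, a used one
    -- has both ends covered. So a path from `s` stays covered throughout.
    ... | no none = es , g , (λ u → spread (conn s u) (base s∈S)) , ≤-trans (a≤a+b (edgeWeight-nonneg metric rest)) weight
      where
      spread : ∀ {u v} → Conn S T u v → Covered S es u → Covered S es v
      spread here                u∈ = u∈
      spread (viaS _ w∈S c)      _  = spread c (base w∈S)
      spread {u} (viaE {w = w} (inj₁ e∈) c) u∈ with track e∈ | covered? S es w
      ... | _             | yes w∈ = spread c w∈
      ... | inj₁ rest∋    | no w∉  = contradiction (lose rest∋ (inj₂ (w∉ , u∈))) none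
      ... | inj₂ (_ , w∈) | no w∉  = contradiction w∈ w∉
      spread {u} (viaE {w = w} (inj₂ e∈) c) u∈ with track e∈ | covered? S es w
      ... | _             | yes w∈ = spread c w∈
      ... | inj₁ rest∋    | no w∉  = contradiction (lose rest∋ (inj₁ (w∉ , u∈))) none
      ... | inj₂ (w∈ , _) | no w∉  = contradiction w∈ w∉
    extend m       rest es len g track weight | yes some with pick some
    extend zero    rest es len g track weight | yes some | _ , _ , _ , _ , _ , len′ , _ = case trans (sym len′) len of λ ()
    extend (suc m) rest es len g track weight | yes some | u , p , rest′ , u∉ , p∈ , len′ , weight′ , locate =
      extend m rest′ ((u , p) ∷ es) (ℕ.suc-injective (trans (sym len′) len)) (grow u∉ p∈ g)
        (λ e∈ → case track e∈ of λ where
          (inj₁ e∈rest)    → locate e∈rest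
          (inj₂ (c₁ , c₂)) → inj₂ (covered-weaken S c₁ , covered-weaken S c₂))
        (≤-trans (≤-reflexive eq) weight)
      where
      eq : (d u p + edgeWeight d es) + edgeWeight d rest′ ≡ edgeWeight d es + edgeWeight d rest
      eq = trans (solve 3 (λ a b c → (a :+ b) :+ c := b :+ (a :+ c)) refl (d u p) (edgeWeight d es) (edgeWeight d rest′))
                 (cong (_+_ (edgeWeight d es)) (sym weight′))

  module _ {S : Subset n} {par : V → V} (reach : ∀ u → Reach S par u) where

    private
      link : V → V × V
      link u = u , par u

    links : List (V × V)
    links = map link (members (∁ S))

    links-weight : edgeWeight d links ≡ sumOver allV (linkCost metric S par)
    links-weight = begin
      edgeWeight d links                                    ≡⟨ as-sum (members (∁ S)) ⟩
      sumOver (members (∁ S)) (λ u → d u (par u))           ≡⟨ sum-filter (_∈? ∁ S) allV _ ⟩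
      sumOver allV (λ u → if-dec (u ∈? ∁ S) (d u (par u)))  ≡⟨ sum-cong allV (λ {u} _ → by-cases u (u ∈? S)) ⟩
      sumOver allV (linkCost metric S par)                  ∎
      where
      open ≡-Reasoning
      as-sum : ∀ us → edgeWeight d (map link us) ≡ sumOver us (λ u → d u (par u))
      as-sum []       = refl
      as-sum (u ∷ us) = cong (_+_ (d u (par u))) (as-sum us)
      by-cases : ∀ u → Dec (u ∈ S) → if-dec (u ∈? ∁ S) (d u (par u)) ≡ linkCost metric S par u
      by-cases u (yes u∈) = trans (if-no (u ∈? ∁ S) (λ u∈∁ → x∈∁p⇒x∉p u∈∁ u∈)) (sym (linkCost-∈ metric u∈))
      by-cases u (no u∉)  = trans (if-yes (u ∈? ∁ S) (x∉p⇒x∈∁p u∉)) (sym (linkCost-∉ metric u∉))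

    -- One edge per vertex outside `S` already gives the edge count of a tree. What remains is
    -- connectivity, obtained by following parents up to the first vertex of `S` and passing through
    -- the contracted vertex.
    links-spanning : IsSpanningTreeContr S links
    links-spanning = record
      { edgesOk   = λ u v uv∈ → edge-ok uv∈
      ; size      = trans (length-map link (members (∁ S))) (trans (length-members (∁ S)) (∣∁p∣≡n∸∣p∣ S))
      ; connected = λ u v → connect (to-root (reach u)) (to-root (reach v))
      }
      where
      edge-ok : ∀ {u v} → (u , v) ∈ₗ links → u ≢ v × ¬ (u ∈ S × v ∈ S)
      edge-ok uv∈ with ∈-map⁻ link uv∈
      ... | u , u∈ , refl = reach-moves S (reach u) u∉ , (u∉ ∘ proj₁)
        where u∉ = x∈∁p⇒x∉p (∈-members⁻ {S = ∁ S} u∈)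
      to-root : ∀ {u} → Reach S par u → ∃ λ s → s ∈ S × Conn S links u s
      to-root (root u∈)    = _ , u∈ , here
      to-root {u} (step r) with u ∈? S | to-root r
      ... | yes u∈ | _            = _ , u∈ , here
      ... | no u∉  | s , s∈ , c = s , s∈ , viaE (inj₁ (∈-map⁺ link (∈-members⁺ (x∉p⇒x∈∁p u∉)))) c
      connect : ∀ {u v} → (∃ λ s → s ∈ S × Conn S links u s) → (∃ λ s → s ∈ S × Conn S links v s) → Conn S links u v
      connect (_ , s∈ , c) (_ , s′∈ , c′) = conn-trans c (viaS s∈ s′∈ (conn-sym c′))

  -- This reduces bounding the tree of a swapped set to exhibiting a parent map and bounding its
  -- cost vertex by vertex.
  mst≤forest : ∀ {S m} → IsMSTWeight d S m → ∀ {par} → (∀ u → Reach S par u) → m ≤ sumOver allV (linkCost metric S par)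
  mst≤forest {m = m} (_ , minimal) reach = subst (m ≤_) (links-weight reach) (minimal _ (links-spanning reach))

-- Existence of minimum spanning trees under double negation

¬¬-lem : ∀ {P : Set} → ¬ ¬ Dec P
¬¬-lem k = k (no (k ∘ yes))

-- `P` comes without a decision procedure. Under a double negation it may be decided at each of the
-- finitely many candidates, after which the usual scan for a minimum applies.
¬¬-minimum : ∀ {A : Set} (P : A → Set) (f : A → ℚ) (xs : List A) →
  ¬ ¬ ((∀ {x} → x ∈ₗ xs → ¬ P x) ⊎ ∃ λ x → P x × (∀ {y} → y ∈ₗ xs → P y → f x ≤ f y))
¬¬-minimum P f []       k = k (inj₁ λ ())
¬¬-minimum P f (x ∷ xs) k = ¬¬-lem λ Px? → ¬¬-minimum P f xs λ m → k (combine Px? m)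
  where
  combine : Dec (P x) → ((∀ {x} → x ∈ₗ xs → ¬ P x) ⊎ ∃ λ x → P x × (∀ {y} → y ∈ₗ xs → P y → f x ≤ f y)) → _
  combine (no ¬Px) (inj₁ none)            = inj₁ λ { (here refl) → ¬Px ; (there x∈) → none x∈ }
  combine (no ¬Px) (inj₂ (z , Pz , min))  = inj₂ (z , Pz , λ { (here refl) Px → contradiction Px ¬Px ; (there y∈) → min y∈ })
  combine (yes Px) (inj₁ none)            = inj₂ (x , Px , λ { (here refl) _ → ≤-refl ; (there y∈) Py → contradiction Py (none y∈) })
  combine (yes Px) (inj₂ (z , Pz , min)) with ≤-total (f x) (f z)
  ... | inj₁ x≤z = inj₂ (x , Px , λ { (here refl) _ → ≤-refl ; (there y∈) Py → ≤-trans x≤z (min y∈ Py) })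
  ... | inj₂ z≤x = inj₂ (z , Pz , λ { (here refl) _ → z≤x ; (there y∈) → min y∈ })

listsOfLength : ∀ {A : Set} → List A → ℕ → List (List A)
listsOfLength as zero    = [] ∷ []
listsOfLength as (suc l) = cartesianProductWith _∷_ as (listsOfLength as l)

∈-listsOfLength : ∀ {A : Set} {as : List A} → (∀ a → a ∈ₗ as) → ∀ xs → xs ∈ₗ listsOfLength as (length xs)
∈-listsOfLength all []       = here refl
∈-listsOfLength all (x ∷ xs) = ∈-cartesianProductWith⁺ _∷_ (all x) (∈-listsOfLength all xs)

-- The fixed number of edges confines all spanning trees to a finite list of candidates, and the
-- given one shows that some candidate qualifies.
¬¬-mst : ∀ {n} (d : Fin n → Fin n → ℚ) {S T} → IsSpanningTreeContr S T → ¬ ¬ ∃ (IsMSTWeight d S)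
¬¬-mst {n} d {S} {T} span k = ¬¬-minimum (IsSpanningTreeContr S) (edgeWeight d) candidates λ where
    (inj₁ none)              → none (candidate span) span
    (inj₂ (T₀ , span₀ , min)) → k (edgeWeight d T₀ , (T₀ , span₀ , refl) , λ T′ span′ → min (candidate span′) span′)
  where
  candidates = listsOfLength (cartesianProductWith _,_ allV allV) (n ∸ ∣ S ∣)
  candidate : ∀ {T} → IsSpanningTreeContr S T → T ∈ₗ candidates
  candidate {T} span = subst (λ l → T ∈ₗ listsOfLength _ l) (IsSpanningTreeContr.size span)
    (∈-listsOfLength (λ (u , v) → ∈-cartesianProductWith⁺ _,_ (∈-allFin u) (∈-allFin v)) T)

-- The distance to a set is attained

module _ {n : ℕ} (d : Fin n → Fin n → ℚ) (S : Subset n) (u : Fin n) where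

  private
    V = Fin n

    merge : Maybe ℚ → ℚ → ℚ
    merge nothing  y = y
    merge (just m) y = m ⊓ y

    -- Specifies one step of the fold in `distToSet`, so that the scan can be analysed without
    -- access to its local function.
    Scan : (V → Maybe ℚ → Maybe ℚ) → Set
    Scan f = ∀ w acc → (w ∉ S × f w acc ≡ acc) ⊎ (w ∈ S × f w acc ≡ just (merge acc (d u w)))

    scan-≤ : ∀ {f} → Scan f → ∀ ws {w} → w ∈ₗ ws → w ∈ S → ∃ λ m → foldr f nothing ws ≡ just m × m ≤ d u w
    scan-≤ {f} scan (w ∷ ws) w∈ws w∈S with scan w (foldr f nothing ws)
    scan-≤ scan (w ∷ ws) (here refl) w∈S | inj₁ (w∉S , _) = contradiction w∈S w∉S
    scan-≤ {f} scan (w ∷ ws) (here refl) w∈S | inj₂ (_ , eq) = _ , eq , merge≤ (foldr f nothing ws)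
      where
      merge≤ : ∀ acc → merge acc (d u w) ≤ d u w
      merge≤ nothing  = ≤-refl
      merge≤ (just m) = p⊓q≤q m (d u w)
    scan-≤ scan (w′ ∷ ws) (there w∈ws) w∈S | choice with choice | scan-≤ scan ws w∈ws w∈S
    ... | inj₁ (_ , eq) | m , eq′ , m≤ = m , trans eq eq′ , m≤
    ... | inj₂ (_ , eq) | m , eq′ , m≤ =
      _ , trans eq (cong (λ acc → just (merge acc (d u w′))) eq′) , ≤-trans (p⊓q≤p m (d u w′)) m≤

    scan-attained : ∀ {f} → Scan f → ∀ ws {m} → foldr f nothing ws ≡ just m → ∃ λ w → w ∈ S × m ≡ d u w
    scan-attained {f} scan (w ∷ ws) eq with scan w (foldr f nothing ws)
    ... | inj₁ (_ , eq′)   = scan-attained scan ws (trans (sym eq′) eq)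
    ... | inj₂ (w∈S , eq′) with foldr f nothing ws in acc≡
    ...   | nothing = w , w∈S , sym (just-injective (trans (sym eq′) eq))
    ...   | just m′ with ⊓-sel m′ (d u w)
    ...     | inj₂ sel = w , w∈S , trans (sym (just-injective (trans (sym eq′) eq))) sel
    ...     | inj₁ sel with scan-attained scan ws acc≡
    ...       | w′ , w′∈S , m≡ = w′ , w′∈S , trans (trans (sym (just-injective (trans (sym eq′) eq))) sel) m≡

    nearest-of : ∀ {f} → distToSet d S u ≡ fromMaybe 0ℚ (foldr f nothing allV) → Scan f → ∃ (_∈ S) →
      ∃ λ w → w ∈ S × distToSet d S u ≡ d u w × (∀ {v} → v ∈ S → d u w ≤ d u v)
    nearest-of {f} dist≡ scan (s , s∈S) with scan-≤ scan allV (∈-allFin s) s∈S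
    ... | m , eq , _ with scan-attained scan allV eq
    ...   | w , w∈S , refl = w , w∈S , trans dist≡ (cong (fromMaybe 0ℚ) eq) , least
      where
      least : ∀ {v} → v ∈ S → d u w ≤ d u v
      least v∈S with scan-≤ scan allV (∈-allFin _) v∈S
      ... | m′ , eq′ , m′≤ = subst (_≤ _) (just-injective (trans (sym eq′) eq)) m′≤

    -- Unification gives a name to the local scanning function of distToSet.
    unfolded : ∃ λ (f : V → Maybe ℚ → Maybe ℚ) → distToSet d S u ≡ fromMaybe 0ℚ (foldr f nothing allV)
    unfolded = _ , refl

    scan : Scan (proj₁ unfolded)
    scan w acc with w ∈? S
    ... | no w∉S  = inj₁ (w∉S , refl)
    ... | yes w∈S with acc
    ...   | nothing = inj₂ (w∈S , refl)
    ...   | just m  = inj₂ (w∈S , refl)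

  nearest : ∃ (_∈ S) → ∃ λ w → w ∈ S × distToSet d S u ≡ d u w × (∀ {v} → v ∈ S → d u w ≤ d u v)
  nearest = nearest-of (proj₂ unfolded) scan

-- Tours of a forest

headOr : {A : Set} → List A → A → A
headOr []      e = e
headOr (a ∷ _) _ = a

module _ {n : ℕ} where

  private
    V = Fin n

  -- The entry after the last occurrence of u in the list, e standing at the end.
  next : List V → V → V → V
  next []      e u = e
  next (a ∷ l) e u with u ∈ₗ? l
  ... | yes _ = next l e u
  ... | no _  = headOr l e

  next-later : ∀ {a l e u} → u ∈ₗ l → next (a ∷ l) e u ≡ next l e u
  next-later {l = l} {u = u} u∈l with u ∈ₗ? l
  ... | yes _  = refl
  ... | no u∉l = contradiction u∈l u∉l

  next-last : ∀ {a l e u} → u ∉ₗ l → next (a ∷ l) e u ≡ headOr l e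
  next-last {l = l} {u = u} u∉l with u ∈ₗ? l
  ... | yes u∈l = contradiction u∈l u∉l
  ... | no _    = refl

  -- Induction from the end of the list. Leaving a vertex after its last occurrence is what makes
  -- `next` acyclic: after the first occurrence, the list a, b, a would send a and b to each other.
  next-induction : ∀ (Q : V → Set) {e} → Q e → ∀ l → (∀ {u} → u ∈ₗ l → Q (next l e u) → Q u) → ∀ {u} → u ∈ₗ l → Q u
  next-induction Q {e} Qe (a ∷ l) back = λ u∈ → by-position u∈ (_ ∈ₗ? l)
    where
    later : ∀ {u} → u ∈ₗ l → Q u
    later = next-induction Q Qe l (λ u∈l q → back (there u∈l) (subst Q (sym (next-later {a = a} {e = e} u∈l)) q))
    Q-head : ∀ l → (∀ {u} → u ∈ₗ l → Q u) → Q (headOr l e)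
    Q-head []      _  = Qe
    Q-head (_ ∷ _) Ql = Ql (here refl)
    by-position : ∀ {u} → u ∈ₗ a ∷ l → Dec (u ∈ₗ l) → Q u
    by-position _          (yes u∈l) = later u∈l
    by-position (there u∈l) (no u∉l) = contradiction u∈l u∉l
    by-position (here refl) (no u∉l) = back (here refl) (subst Q (sym (next-last {a = a} {e = e} u∉l)) (Q-head l later))

  -- The chain at `u` is copied and not cleared. This is harmless: in a `Grown` list the leaf `u`
  -- does not occur among the vertices that remain after the contraction.
  mergeAt : V → V → (V → List V) → V → List V
  mergeAt u p ch w with w Fin.≟ p
  ... | yes _ = ch p ++ ch u
  ... | no _  = ch w

  -- Contracts the edges of a forest one after the other, leaves first, concatenating the chains held by the two ends.
  tour : List (V × V) → (V → List V) → V → List V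
  tour []             ch = ch
  tour ((u , p) ∷ es) ch = tour es (mergeAt u p ch)

  tour-sound : ∀ (F : Subset n) (o : V → V) {es} → All (λ e → o (proj₂ e) ≡ o (proj₁ e)) es → ∀ {ch} →
    (∀ {w a} → a ∈ₗ ch w → a ∈ F × o a ≡ o w) → ∀ {w a} → a ∈ₗ tour es ch w → a ∈ F × o a ≡ o w
  tour-sound F o []                               sound = sound
  tour-sound F o {(u , p) ∷ es} (op≡ou ∷ o-es) {ch} sound = tour-sound F o o-es merged
    where
    merged : ∀ {w a} → a ∈ₗ mergeAt u p ch w → a ∈ F × o a ≡ o w
    merged {w} a∈ with w Fin.≟ p
    ... | no _     = sound a∈
    ... | yes refl with ∈-++⁻ (ch p) a∈
    ...   | inj₁ a∈p = sound a∈p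
    ...   | inj₂ a∈u = proj₁ (sound a∈u) , trans (proj₂ (sound a∈u)) (sym op≡ou)

  tour-complete : ∀ (S : Subset n) {es} → Grown S es → ∀ {ch w a} → Covered S es w → a ∈ₗ ch w →
    ∃ λ x → x ∈ S × a ∈ₗ tour es ch x
  tour-complete S []                                     (base w∈S) a∈ = _ , w∈S , a∈
  tour-complete S {(u , p) ∷ es} (grow u∉ p∈ g) {ch} {w} {a} w∈ a∈ with w Fin.≟ u
  ... | yes refl = tour-complete S g p∈ at-p
    where
    at-p : a ∈ₗ mergeAt u p ch p
    at-p with p Fin.≟ p
    ... | yes _  = ∈-++⁺ʳ (ch p) a∈
    ... | no p≢p = contradiction refl p≢p
  ... | no w≢u   = tour-complete S g (covered-tail S w∈ w≢u) at-w
    where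
    at-w : a ∈ₗ mergeAt u p ch w
    at-w with w Fin.≟ p
    ... | yes refl = ∈-++⁺ˡ a∈
    ... | no _     = a∈

-- Lengths of tours, and links along them

module _ {n : ℕ} {d : Fin n → Fin n → ℚ} (metric : IsMetric d) where

  private
    V = Fin n
    open IsMetric metric renaming (sym to d-sym)

  walk : V → List V → V → ℚ
  walk x []      y = d x y
  walk x (a ∷ l) y = d x a + walk a l y

  loop : V → List V → ℚ
  loop x l = walk x l x

  walk-nonneg : ∀ x l y → 0ℚ ≤ walk x l y
  walk-nonneg x []      y = nonneg x y
  walk-nonneg x (a ∷ l) y = +-nonneg (nonneg x a) (walk-nonneg a l y)

  walk-start : ∀ x l y p → walk x l y ≤ d x p + walk p l y
  walk-start x []      y p = triangle x p y
  walk-start x (a ∷ l) y p = begin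
    d x a + walk a l y           ≤⟨ +-monoˡ-≤ (walk a l y) (triangle x p a) ⟩
    (d x p + d p a) + walk a l y ≡⟨ +-assoc (d x p) (d p a) (walk a l y) ⟩
    d x p + (d p a + walk a l y) ∎
    where open ≤-Reasoning

  walk-++ : ∀ x l l′ y p → walk x (l ++ l′) y ≤ walk x l p + walk p l′ y
  walk-++ x []      l′ y p = walk-start x l′ y p
  walk-++ x (a ∷ l) l′ y p = ≤-trans (+-monoʳ-≤ (d x a) (walk-++ a l l′ y p))
    (≤-reflexive (sym (+-assoc (d x a) (walk a l p) (walk p l′ y))))

  walk-end : ∀ x l y p → walk x l y ≤ walk x l p + d p y
  walk-end x []      y p = triangle x p y
  walk-end x (a ∷ l) y p = ≤-trans (+-monoʳ-≤ (d x a) (walk-end a l y p))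
    (≤-reflexive (sym (+-assoc (d x a) (walk a l p) (d p y))))

  -- Doubling of the tree edge: back at `p` after its own chain, the tour makes an excursion to `u`,
  -- runs round the chain of `u` and returns. Shortcutting by the triangle inequality gives the
  -- concatenated chain.
  loop-merge : ∀ u p ch w → loop w (mergeAt u p ch w) ≤
    loop w (ch w) + if-dec (w Fin.≟ p) (loop u (ch u) + (d u p + d u p))
  loop-merge u p ch w with w Fin.≟ p
  ... | no _     = ≤-reflexive (sym (+-identityʳ _))
  ... | yes refl = begin
    loop p (ch p ++ ch u)                                 ≤⟨ walk-++ p (ch p) (ch u) p p ⟩
    loop p (ch p) + walk p (ch u) p                       ≤⟨ +-monoʳ-≤ (loop p (ch p)) (walk-start p (ch u) p u) ⟩
    loop p (ch p) + (d p u + walk u (ch u) p)             ≤⟨ +-monoʳ-≤ (loop p (ch p)) (+-monoʳ-≤ (d p u) (walk-end u (ch u) p u)) ⟩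
    loop p (ch p) + (d p u + (loop u (ch u) + d u p))     ≡⟨ cong (λ x → loop p (ch p) + (x + (loop u (ch u) + d u p))) (d-sym p u) ⟩
    loop p (ch p) + (d u p + (loop u (ch u) + d u p))     ≡⟨ solve 3 (λ a b c → a :+ (b :+ (c :+ b)) := a :+ (c :+ (b :+ b))) refl (loop p (ch p)) (d u p) (loop u (ch u)) ⟩
    loop p (ch p) + (loop u (ch u) + (d u p + d u p))     ∎
    where open ≤-Reasoning

  module _ (S : Subset n) where

    vertices : List (V × V) → List V
    vertices []             = members S
    vertices ((u , _) ∷ es) = u ∷ vertices es

    ∈-vertices : ∀ es {u} → u ∈ₗ vertices es → Covered S es u
    ∈-vertices []       u∈          = base (∈-members⁻ u∈)
    ∈-vertices (e ∷ es) (here refl) = added (here refl)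
    ∈-vertices (e ∷ es) (there u∈)  = covered-weaken S (∈-vertices es u∈)

    vertices-unique : ∀ {es} → Grown S es → Unique (vertices es)
    vertices-unique []                      = members-unique S
    vertices-unique {_ ∷ es} (grow u∉ _ g) = All.tabulate (λ { v∈ refl → u∉ (∈-vertices es v∈) }) ∷ vertices-unique g

    -- A contraction transfers the loop of the leaf to its parent and pays the edge twice, so the
    -- loops of the vertices still present grow in total by at most twice the contracted weight.
    tour-cost : ∀ {es} → Grown S es → ∀ ch → sumOver (members S) (λ x → loop x (tour es ch x)) ≤
      sumOver (vertices es) (λ v → loop v (ch v)) + (edgeWeight d es + edgeWeight d es)
    tour-cost []                              ch = ≤-reflexive (sym (trans (cong (_+_ X) (+-identityˡ 0ℚ)) (+-identityʳ X)))
      where X = sumOver (members S) (λ v → loop v (ch v))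
    tour-cost {(u , p) ∷ es} (grow _ _ g) ch = begin
      sumOver (members S) (λ x → loop x (tour es (mergeAt u p ch) x))
        ≤⟨ tour-cost g (mergeAt u p ch) ⟩
      sumOver (vertices es) (λ v → loop v (mergeAt u p ch v)) + (W + W)
        ≤⟨ +-monoˡ-≤ (W + W) (sum-mono (vertices es) (λ {v} _ → loop-merge u p ch v)) ⟩
      sumOver (vertices es) (λ v → loop v (ch v) + if-dec (v Fin.≟ p) X) + (W + W)
        ≡⟨ cong (_+ (W + W)) (sum-+ (vertices es) (λ v → loop v (ch v)) (λ v → if-dec (v Fin.≟ p) X)) ⟩
      (L + sumOver (vertices es) (λ v → if-dec (v Fin.≟ p) X)) + (W + W)
        ≤⟨ +-monoˡ-≤ (W + W) (+-monoʳ-≤ L (sum-point≤ (vertices es) (vertices-unique g) p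
             (+-nonneg (walk-nonneg u (ch u) u) (+-nonneg (nonneg u p) (nonneg u p))))) ⟩
      (L + (loop u (ch u) + (d u p + d u p))) + (W + W)
        ≡⟨ solve 4 (λ l c e w → (l :+ (c :+ (e :+ e))) :+ (w :+ w) := (c :+ l) :+ ((e :+ w) :+ (e :+ w)))
             refl L (loop u (ch u)) (d u p) W ⟩
      (loop u (ch u) + L) + ((d u p + W) + (d u p + W)) ∎
      where
      open ≤-Reasoning
      W = edgeWeight d es
      L = sumOver (vertices es) (λ v → loop v (ch v))
      X = loop u (ch u) + (d u p + d u p)

  pathLength : List V → V → ℚ
  pathLength []      e = 0ℚ
  pathLength (a ∷ l) e = walk a l e

  pathLength-∷ : ∀ a l e → pathLength (a ∷ l) e ≡ d a (headOr l e) + pathLength l e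
  pathLength-∷ a []      e = sym (+-identityʳ _)
  pathLength-∷ a (_ ∷ _) e = refl

  -- Each entry is charged the step of the path out of its last occurrence, so no step is charged
  -- twice.
  next-cost : ∀ l e → sumOver allV (λ u → if-dec (u ∈ₗ? l) (d u (next l e u))) ≤ pathLength l e
  next-cost []      e = ≤-reflexive (sum-zero (allV {n}) (λ _ → refl))
  next-cost (a ∷ l) e = begin
    sumOver allV (λ u → if-dec (u ∈ₗ? (a ∷ l)) (d u (next (a ∷ l) e u)))
      ≤⟨ sum-mono allV (λ {u} _ → bound u (u ∈ₗ? (a ∷ l)) (u Fin.≟ a) (u ∈ₗ? l)) ⟩
    sumOver allV (λ u → if-dec (u Fin.≟ a) X + if-dec (u ∈ₗ? l) (d u (next l e u)))
      ≡⟨ sum-+ allV (λ u → if-dec (u Fin.≟ a) X) (λ u → if-dec (u ∈ₗ? l) (d u (next l e u))) ⟩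
    sumOver allV (λ u → if-dec (u Fin.≟ a) X) + sumOver allV (λ u → if-dec (u ∈ₗ? l) (d u (next l e u)))
      ≤⟨ +-mono-≤ (sum-point≤ allV (allFin⁺ n) a (nonneg a _)) (next-cost l e) ⟩
    X + pathLength l e
      ≡⟨ pathLength-∷ a l e ⟨
    pathLength (a ∷ l) e ∎
    where
    open ≤-Reasoning
    X = d a (headOr l e)
    bound : ∀ u (x? : Dec (u ∈ₗ a ∷ l)) (y? : Dec (u ≡ a)) (z? : Dec (u ∈ₗ l)) →
      if-dec x? (d u (next (a ∷ l) e u)) ≤ if-dec y? X + if-dec z? (d u (next l e u))
    bound u (no _) y? z? = +-nonneg (if-nonneg y? (nonneg a _)) (if-nonneg z? (nonneg u _))
    bound u (yes _) y? (yes u∈l) = ≤-trans (≤-reflexive (cong (d u) (next-later {a = a} {e = e} u∈l))) (a≤b+a (if-nonneg y? (nonneg a _)))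
    bound u (yes _) (yes refl) (no u∉l) = ≤-reflexive (trans (cong (d u) (next-last {a = a} {e = e} u∉l)) (sym (+-identityʳ _)))
    bound u (yes (here u≡a)) (no u≢a) (no _) = contradiction u≡a u≢a
    bound u (yes (there u∈l)) _ (no u∉l) = contradiction u∈l u∉l

  module Patch (F S : Subset n) (η : V → V) (η∈ : ∀ x → η x ∈ F) (η-least : ∀ x {v} → v ∈ F → d x (η x) ≤ d x v)
               {es} (grown : Grown S es) (spans : ∀ u → Covered S es u) where

    private
      o = rootOf S es

    o∈ : ∀ u → o u ∈ S
    o∈ u = rootOf∈ S grown (spans u)

    seed : V → List V
    seed w with w ∈? F
    ... | yes _ = w ∷ []
    ... | no _  = []

    chain : V → List V
    chain = tour es seed

    seed-sound : ∀ {w a} → a ∈ₗ seed w → a ∈ F × o a ≡ o w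
    seed-sound {w} a∈ with w ∈? F
    seed-sound (here refl) | yes w∈ = w∈ , refl

    seed-complete : ∀ {w} → w ∈ F → w ∈ₗ seed w
    seed-complete {w} w∈ with w ∈? F
    ... | yes _ = here refl
    ... | no w∉ = contradiction w∈ w∉

    seed-loop : ∀ w → loop w (seed w) ≡ 0ℚ
    seed-loop w with w ∈? F
    ... | yes _ = trans (cong₂ _+_ (refl0 w) (refl0 w)) (+-identityˡ 0ℚ)
    ... | no _  = refl0 w

    chain-sound : ∀ {w a} → a ∈ₗ chain w → a ∈ F × o a ≡ o w
    chain-sound = tour-sound F o (rootOf-edges S grown) seed-sound

    chain-complete : ∀ {u} → u ∈ F → u ∈ₗ chain (o u)
    chain-complete {u} u∈ with tour-complete S grown (spans u) (seed-complete u∈)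
    ... | x , x∈ , u∈x = subst (λ y → u ∈ₗ chain y)
      (sym (trans (proj₂ (chain-sound u∈x)) (rootOf-self S grown x∈))) u∈x

    -- If the root of a component is not added then η of it is not deleted, so following patch leaves the deleted centres.
    patch : V → V
    patch u = next (chain (o u)) (η (o u)) u

    patchCost : V → ℚ
    patchCost u = if-dec (u ∈? F) (d u (patch u))

    patchCost-nonneg : ∀ u → 0ℚ ≤ patchCost u
    patchCost-nonneg u = if-nonneg (u ∈? F) (nonneg u (patch u))

    -- η x is at least as close to x as the first vertex of the chain, so the broken loop costs no more than the closed one.
    chain-loop : ∀ x l → (∀ {a} → a ∈ₗ l → a ∈ F) → pathLength l (η x) ≤ loop x l
    chain-loop x []      l⊆F = nonneg x x
    chain-loop x (a ∷ l) l⊆F = begin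
      walk a l (η x)           ≤⟨ walk-end a l (η x) x ⟩
      walk a l x + d x (η x)   ≤⟨ +-monoʳ-≤ (walk a l x) (η-least x (l⊆F (here refl))) ⟩
      walk a l x + d x a       ≡⟨ +-comm (walk a l x) (d x a) ⟩
      d x a + walk a l x       ∎
      where open ≤-Reasoning

    sum-patchCost : sumOver allV patchCost ≤ edgeWeight d es + edgeWeight d es
    sum-patchCost = begin
      sumOver allV patchCost
        ≡⟨ sum-cong allV (λ {u} _ → sym (if-yes (o u ∈ₗ? members S) (∈-members⁺ (o∈ u)))) ⟩
      sumOver allV (λ u → if-dec (o u ∈ₗ? members S) (patchCost u))
        ≡⟨ sum-classes (members S) (members-unique S) o patchCost ⟨
      sumOver (members S) (λ x → sumOver allV (λ u → if-dec (o u Fin.≟ x) (patchCost u)))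
        ≤⟨ sum-mono (members S) (λ {x} _ → sum-mono allV (λ {u} _ → bound x u (o u Fin.≟ x) (u ∈? F))) ⟩
      sumOver (members S) (λ x → sumOver allV (λ u → if-dec (u ∈ₗ? chain x) (d u (next (chain x) (η x) u))))
        ≤⟨ sum-mono (members S) (λ {x} _ → ≤-trans (next-cost (chain x) (η x)) (chain-loop x (chain x) (proj₁ ∘ chain-sound))) ⟩
      sumOver (members S) (λ x → loop x (chain x))
        ≤⟨ tour-cost S grown seed ⟩
      sumOver (vertices S es) (λ v → loop v (seed v)) + (edgeWeight d es + edgeWeight d es)
        ≡⟨ trans (cong (_+ (edgeWeight d es + edgeWeight d es)) (sum-zero (vertices S es) (λ {v} _ → seed-loop v))) (+-identityˡ _) ⟩
      edgeWeight d es + edgeWeight d es ∎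
      where
      open ≤-Reasoning
      bound : ∀ x u (o≟ : Dec (o u ≡ x)) (u∈? : Dec (u ∈ F)) →
        if-dec o≟ (if-dec u∈? (d u (patch u))) ≤ if-dec (u ∈ₗ? chain x) (d u (next (chain x) (η x) u))
      bound x u (no _)     u∈?      = if-nonneg (u ∈ₗ? chain x) (nonneg u _)
      bound x u (yes _)    (no _)   = if-nonneg (u ∈ₗ? chain x) (nonneg u _)
      bound x u (yes refl) (yes u∈) = ≤-reflexive (sym (if-yes (u ∈ₗ? chain (o u)) (chain-complete u∈)))

-- Splitting the cost change of a swap over the centres

module _ {n : ℕ} where

  private
    V = Fin n

  -- `D` and `A` are the lists used for accounting. `S` is only bounded from below by them, which
  -- allows a common centre to be charged as added although the set does not change.
  record ValidSwap (F F* : Subset n) (η : V → V) (D A : List V) (S : Subset n) : Set where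
    field
      keeps  : ∀ {u} → u ∈ F → u ∉ₗ D → u ∈ S
      adds   : ∀ {x} → x ∈ₗ A → x ∈ S
      closed : ∀ {x} → x ∈ F* → η x ∈ₗ D → x ∈ₗ A

  -- A cost that splits over the vertices as c for F and as c* for F*. A swap lowers c to c* on the vertices that o
  -- assigns to an added centre, at the price of pen on the vertices that s assigns to a deleted one.
  module Account (c c* pen : V → ℚ) (pen-nonneg : ∀ u → 0ℚ ≤ pen u) (o s : V → V) where

    afterSwap : List V → List V → V → ℚ
    afterSwap D A u = c u + (if-dec (o u ∈ₗ? A) (c* u - c u) + if-dec (s u ∈ₗ? D) (pen u))

    gain : V → ℚ
    gain x = sumOver allV (λ u → if-dec (o u Fin.≟ x) (c* u - c u))

    penalty : V → ℚ
    penalty f = sumOver allV (λ u → if-dec (s u Fin.≟ f) (pen u))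

    penalty-nonneg : ∀ f → 0ℚ ≤ penalty f
    penalty-nonneg f = sum-nonneg allV (λ {u} _ → if-nonneg (s u Fin.≟ f) (pen-nonneg u))

    sum-afterSwap : ∀ {D A} → Unique D → Unique A →
      sumOver allV (afterSwap D A) ≡ sumOver allV c + (sumOver A gain + sumOver D penalty)
    sum-afterSwap {D} {A} uD uA = begin
      sumOver allV (λ u → c u + (g u + l u))              ≡⟨ sum-+ allV c (λ u → g u + l u) ⟩
      sumOver allV c + sumOver allV (λ u → g u + l u)     ≡⟨ cong (_+_ (sumOver allV c)) (sum-+ allV g l) ⟩
      sumOver allV c + (sumOver allV g + sumOver allV l)
        ≡⟨ cong₂ (λ x y → sumOver allV c + (x + y)) (sum-classes A uA o (λ u → c* u - c u)) (sum-classes D uD s pen) ⟨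
      sumOver allV c + (sumOver A gain + sumOver D penalty) ∎
      where
      open ≡-Reasoning
      g l : V → ℚ
      g u = if-dec (o u ∈ₗ? A) (c* u - c u)
      l u = if-dec (s u ∈ₗ? D) (pen u)

    sum-gain : ∀ S → (∀ u → o u ∈ S) → sumOver (members S) gain ≡ sumOver allV c* - sumOver allV c
    sum-gain S o∈ = begin
      sumOver (members S) gain
        ≡⟨ sum-classes (members S) (members-unique S) o (λ u → c* u - c u) ⟩
      sumOver allV (λ u → if-dec (o u ∈ₗ? members S) (c* u - c u))
        ≡⟨ sum-cong allV (λ {u} _ → if-yes (o u ∈ₗ? members S) (∈-members⁺ (o∈ u))) ⟩
      sumOver allV (λ u → c* u - c u)
        ≡⟨ trans (sum-+ allV c* (λ u → - c u)) (cong (_+_ (sumOver allV c*)) (sum-neg allV c)) ⟩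
      sumOver allV c* - sumOver allV c ∎
      where open ≡-Reasoning

    sum-penalty : ∀ S → sumOver (members S) penalty ≤ sumOver allV pen
    sum-penalty S = ≤-trans (≤-reflexive (sum-classes (members S) (members-unique S) s pen))
      (sum-mono allV (λ {u} _ → if-≤ (s u ∈ₗ? members S) (pen-nonneg u)))

-- Rerouting the tree edges and the clients after a swap

module _ {n : ℕ} {d : Fin n → Fin n → ℚ} (metric : IsMetric d) where

  private
    V = Fin n
    open IsMetric metric renaming (sym to d-sym)

  module ForestSwap (F F* : Subset n) (η : V → V) (η∈ : ∀ x → η x ∈ F) (η-least : ∀ x {v} → v ∈ F → d x (η x) ≤ d x v)
                    {es} (grown : Grown F es) (spans : ∀ u → Covered F es u)
                    {es*} (grown* : Grown F* es*) (spans* : ∀ u → Covered F* es* u) where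

    open Patch metric F F* η η∈ η-least grown* spans* public

    o = rootOf F* es*
    p = parent F es
    p* = parent F* es*

    -- A new link is paid by the deleted centre itself, hence `id` as the assignment of penalties.
    open Account (linkCost metric F p) (linkCost metric F* p*) patchCost patchCost-nonneg o id public

    module _ {D A : List V} {S : Subset n} (swap : ValidSwap F F* η D A S) where

      open ValidSwap swap

      reroute : V → V
      reroute u with o u ∈ₗ? A | u ∈? F
      ... | yes _ | _     = p* u
      ... | no _  | yes _ = patch u
      ... | no _  | no _  = p u

      reroute-A : ∀ {u} → o u ∈ₗ A → reroute u ≡ p* u
      reroute-A {u} ou∈A with o u ∈ₗ? A | u ∈? F
      ... | yes _    | _ = refl
      ... | no  ou∉A | _ = contradiction ou∈A ou∉A

      reroute-F : ∀ {u} → o u ∉ₗ A → u ∈ F → reroute u ≡ patch u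
      reroute-F {u} ou∉A u∈F with o u ∈ₗ? A | u ∈? F
      ... | yes ou∈A | _      = contradiction ou∈A ou∉A
      ... | no _     | yes _  = refl
      ... | no _     | no u∉F = contradiction u∈F u∉F

      reroute-∉ : ∀ {u} → o u ∉ₗ A → u ∉ F → reroute u ≡ p u
      reroute-∉ {u} ou∉A u∉F with o u ∈ₗ? A | u ∈? F
      ... | yes ou∈A | _       = contradiction ou∈A ou∉A
      ... | no _     | yes u∈F = contradiction u∈F u∉F
      ... | no _     | no _    = refl

      follow : ∀ {u v} → reroute u ≡ v → Reach S reroute v → Reach S reroute u
      follow eq r = step (subst (Reach S reroute) (sym eq) r)

      reach-A : ∀ {u} → o u ∈ₗ A → Reach F* p* u → Reach S reroute u
      reach-A {u} ou∈A (root u∈F*) = root (adds (subst (_∈ₗ A) (rootOf-self F* grown* u∈F*) ou∈A))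
      reach-A {u} ou∈A (step r)    = follow (reroute-A ou∈A)
        (reach-A (subst (_∈ₗ A) (sym (rootOf-parent F* grown* (spans* u))) ou∈A) r)

      reach-F : ∀ {u} → o u ∉ₗ A → u ∈ F → Reach S reroute u
      reach-F {u} ou∉A u∈F = next-induction (Reach S reroute)
        (root (keeps (η∈ (o u)) (λ η∈D → ou∉A (closed (o∈ u) η∈D)))) (chain (o u)) back (chain-complete u∈F)
        where
        back : ∀ {v} → v ∈ₗ chain (o u) → Reach S reroute (next (chain (o u)) (η (o u)) v) → Reach S reroute v
        back {v} v∈ r with chain-sound v∈
        ... | v∈F , ov≡oou = follow (reroute-F (subst (_∉ₗ A) (sym ov≡ou) ou∉A) v∈F)
            (subst (λ x → Reach S reroute (next (chain x) (η x) v)) (sym ov≡ou) r)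
          where
          ov≡ou : o v ≡ o u
          ov≡ou = trans ov≡oou (rootOf-self F* grown* (o∈ u))

      -- Induction along the path in T, abandoned as soon as it enters a component rooted in `A` or
      -- meets `F`. From there the path needs no further edge of T unless it enters neither.
      reach-p : ∀ {u} → Reach F p u → Reach S reroute u
      reach-p {u} r with o u ∈ₗ? A | u ∈? F
      reach-p {u} r        | yes ou∈A | _       = reach-A ou∈A (parent-reach F* grown* (spans* u))
      reach-p {u} r        | no ou∉A  | yes u∈F = reach-F ou∉A u∈F
      reach-p {u} (root u∈F) | no _   | no u∉F  = contradiction u∈F u∉F
      reach-p {u} (step r) | no ou∉A  | no u∉F  = follow (reroute-∉ ou∉A u∉F) (reach-p r)

      reroute-reach : ∀ u → Reach S reroute u
      reroute-reach u = reach-p (parent-reach F grown (spans u))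

      reroute-cost : ∀ u → linkCost metric S reroute u ≤ afterSwap D A u
      reroute-cost u = by-cases (u ∈? S) (u ∈? F) (o u ∈ₗ? A) (u ∈ₗ? D)
        where
        c  = linkCost metric F p u
        c* = linkCost metric F* p* u
        c≥0  = linkCost-nonneg metric F p u
        c*≥0 = linkCost-nonneg metric F* p* u
        switched : ∀ {e} → 0ℚ ≤ e → c* ≤ c + ((c* - c) + e)
        switched {e} 0≤e = ≤-trans (a≤a+b 0≤e)
          (≤-reflexive (solve 3 (λ a b e → a :+ e := b :+ ((a :- b) :+ e)) refl c* c e))
        unchanged : ∀ {e} → 0ℚ ≤ e → c ≤ c + (0ℚ + e)
        unchanged 0≤e = a≤a+b (+-nonneg ≤-refl 0≤e)
        by-cases : Dec (u ∈ S) → Dec (u ∈ F) → (A? : Dec (o u ∈ₗ A)) (D? : Dec (u ∈ₗ D)) →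
          linkCost metric S reroute u ≤ c + (if-dec A? (c* - c) + if-dec D? (patchCost u))
        -- A vertex of `S` pays nothing, so the right side only has to be nonnegative. The
        -- difference `c* - c` may be negative, but together with `c` it leaves `c*`.
        by-cases (yes u∈S) _ (yes _) D? = ≤-trans (≤-reflexive (linkCost-∈ metric u∈S))
          (≤-trans c*≥0 (switched (if-nonneg D? (patchCost-nonneg u))))
        by-cases (yes u∈S) _ (no _) D? = ≤-trans (≤-reflexive (linkCost-∈ metric u∈S))
          (≤-trans c≥0 (unchanged (if-nonneg D? (patchCost-nonneg u))))
        by-cases (no u∉S) _ (yes ou∈A) D? = ≤-trans (≤-reflexive
          (trans (linkCost-∉ metric u∉S) (trans (cong (d u) (reroute-A ou∈A)) (sym (linkCost-∉ metric u∉F*)))))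
          (switched (if-nonneg D? (patchCost-nonneg u)))
          where
          -- A vertex of `F*` is its own root, so here it would have been added. Hence its optimal
          -- link is a genuine edge of T*.
          u∉F* : u ∉ F*
          u∉F* u∈F* = u∉S (adds (subst (_∈ₗ A) (rootOf-self F* grown* u∈F*) ou∈A))
        by-cases (no u∉S) (no u∉F) (no ou∉A) D? = ≤-trans (≤-reflexive
          (trans (linkCost-∉ metric u∉S) (trans (cong (d u) (reroute-∉ ou∉A u∉F)) (sym (linkCost-∉ metric u∉F)))))
          (unchanged (if-nonneg D? (patchCost-nonneg u)))
        by-cases (no u∉S) (yes u∈F) (no ou∉A) (no u∉D) = contradiction (keeps u∈F u∉D) u∉S
        by-cases (no u∉S) (yes u∈F) (no ou∉A) (yes _) = ≤-trans (≤-reflexive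
          (trans (linkCost-∉ metric u∉S) (trans (cong (d u) (reroute-F ou∉A u∈F)) (sym (if-yes (u ∈? F) u∈F)))))
          (≤-trans (a≤b+a {patchCost u} ≤-refl) (a≤b+a c≥0))

  module ServiceSwap (q : V → ℚ) (q≥0 : ∀ u → 0ℚ ≤ q u) (F F* : Subset n) (ne : ∃ (_∈ F)) (ne* : ∃ (_∈ F*)) where

    s o : V → V
    s u = proj₁ (nearest d F u ne)
    o u = proj₁ (nearest d F* u ne*)

    s∈ : ∀ u → s u ∈ F
    s∈ u = proj₁ (proj₂ (nearest d F u ne))

    s-least : ∀ u {v} → v ∈ F → d u (s u) ≤ d u v
    s-least u = proj₂ (proj₂ (proj₂ (nearest d F u ne)))

    o∈ : ∀ u → o u ∈ F*
    o∈ u = proj₁ (proj₂ (nearest d F* u ne*))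

    c c* pen : V → ℚ
    c u   = q u * distToSet d F u
    c* u  = q u * distToSet d F* u
    pen u = c* u + c* u

    c≡ : ∀ u → c u ≡ q u * d u (s u)
    c≡ u = cong (q u *_) (proj₁ (proj₂ (proj₂ (nearest d F u ne))))

    c*≡ : ∀ u → c* u ≡ q u * d u (o u)
    c*≡ u = cong (q u *_) (proj₁ (proj₂ (proj₂ (nearest d F* u ne*))))

    c*-nonneg : ∀ u → 0ℚ ≤ c* u
    c*-nonneg u = subst (0ℚ ≤_) (sym (c*≡ u)) (*-nonneg (q≥0 u) (nonneg u (o u)))

    pen-nonneg : ∀ u → 0ℚ ≤ pen u
    pen-nonneg u = +-nonneg (c*-nonneg u) (c*-nonneg u)

    open Account c c* pen pen-nonneg o s public

    service-cost : ∀ {D A S} → ValidSwap F F* s D A S → ∀ u → q u * distToSet d S u ≤ afterSwap D A u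
    service-cost {D} {A} {S} swap u = by-cases (o u ∈ₗ? A) (s u ∈ₗ? D)
      where
      open ValidSwap swap
      open ≤-Reasoning
      via : ∀ {w} → w ∈ S → q u * distToSet d S u ≤ q u * d u w
      via {w} w∈S with nearest d S u (w , w∈S)
      ... | v , _ , dist≡ , least = subst (λ x → q u * x ≤ q u * d u w) (sym dist≡)
        (*-monoˡ-≤-nonNeg (q u) {{nonNegative (q≥0 u)}} (least w∈S))
      -- `s (o u)` is at most as far from `o u` as `s u` is, and it survives whenever `o u` is not
      -- added. The excess is the source of `pen`, twice the optimal cost.
      detour : d u (s (o u)) ≤ d u (s u) + (d u (o u) + d u (o u))
      detour = begin
        d u (s (o u))                               ≤⟨ triangle u (o u) (s (o u)) ⟩
        d u (o u) + d (o u) (s (o u))               ≤⟨ +-monoʳ-≤ (d u (o u)) (s-least (o u) (s∈ u)) ⟩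
        d u (o u) + d (o u) (s u)                   ≤⟨ +-monoʳ-≤ (d u (o u)) (triangle (o u) u (s u)) ⟩
        d u (o u) + (d (o u) u + d u (s u))         ≡⟨ cong (λ x → d u (o u) + (x + d u (s u))) (d-sym (o u) u) ⟩
        d u (o u) + (d u (o u) + d u (s u))         ≡⟨ solve 2 (λ a b → a :+ (a :+ b) := b :+ (a :+ a)) refl (d u (o u)) (d u (s u)) ⟩
        d u (s u) + (d u (o u) + d u (o u))         ∎
      by-cases : (A? : Dec (o u ∈ₗ A)) (D? : Dec (s u ∈ₗ D)) →
        q u * distToSet d S u ≤ c u + (if-dec A? (c* u - c u) + if-dec D? (pen u))
      by-cases (yes ou∈A) D? = begin
        q u * distToSet d S u   ≤⟨ via (adds ou∈A) ⟩
        q u * d u (o u)         ≡⟨ c*≡ u ⟨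
        c* u                    ≤⟨ a≤a+b (if-nonneg D? (pen-nonneg u)) ⟩
        c* u + if-dec D? (pen u) ≡⟨ solve 3 (λ a b e → a :+ e := b :+ ((a :- b) :+ e)) refl (c* u) (c u) (if-dec D? (pen u)) ⟩
        c u + ((c* u - c u) + if-dec D? (pen u)) ∎
      by-cases (no ou∉A) (no su∉D) = begin
        q u * distToSet d S u   ≤⟨ via (keeps (s∈ u) su∉D) ⟩
        q u * d u (s u)         ≡⟨ c≡ u ⟨
        c u                     ≤⟨ a≤a+b ≤-refl ⟩
        c u + (0ℚ + 0ℚ)         ∎
      by-cases (no ou∉A) (yes su∈D) = begin
        q u * distToSet d S u   ≤⟨ via (keeps (s∈ (o u)) (λ sou∈D → ou∉A (closed (o∈ u) sou∈D))) ⟩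
        q u * d u (s (o u))     ≤⟨ *-monoˡ-≤-nonNeg (q u) {{nonNegative (q≥0 u)}} detour ⟩
        q u * (d u (s u) + (d u (o u) + d u (o u)))
          ≡⟨ solve 3 (λ q a b → q :* (a :+ (b :+ b)) := q :* a :+ (q :* b :+ q :* b)) refl (q u) (d u (s u)) (d u (o u)) ⟩
        q u * d u (s u) + (q u * d u (o u) + q u * d u (o u))
          ≡⟨ cong₂ (λ x y → x + (y + y)) (c≡ u) (c*≡ u) ⟨
        c u + pen u             ≡⟨ cong (_+_ (c u)) (+-identityˡ (pen u)) ⟨
        c u + (0ℚ + pen u)      ∎

-- Averaging over swaps

-- Division normalises by a gcd and does not compute on variables. Unnormalised fractions turn the
-- identities below into polynomial identities over the integers.
toℚᵘ-/ : ∀ i k → toℚᵘ (i / suc k) ℚᵘ.≃ mkℚᵘ i k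
toℚᵘ-/ i k = toℚᵘ-fromℚᵘ (mkℚᵘ i k)

suc/1 : ∀ m → + suc m / 1 ≡ 1ℚ + + m / 1
suc/1 m = toℚᵘ-injective (begin
  toℚᵘ (+ suc m / 1)                     ≈⟨ toℚᵘ-/ (+ suc m) 0 ⟩
  mkℚᵘ (+ suc m) 0                       ≈⟨ *≡* (S.solve 1 (λ m → (S.con (+ 1) S.:+ m) S.:* S.con (+ 1) S.:= (S.con (+ 1) S.:* S.con (+ 1) S.:+ m S.:* S.con (+ 1)) S.:* S.con (+ 1)) refl (+ m)) ⟩
  mkℚᵘ (+ 1) 0 ℚᵘ.+ mkℚᵘ (+ m) 0         ≈⟨ ℚᵘ.+-congʳ (mkℚᵘ (+ 1) 0) (toℚᵘ-/ (+ m) 0) ⟨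
  toℚᵘ 1ℚ ℚᵘ.+ toℚᵘ (+ m / 1)            ≈⟨ toℚᵘ-homo-+ 1ℚ (+ m / 1) ⟨
  toℚᵘ (1ℚ + + m / 1)                    ∎)
  where
  open ℚᵘ.≃-Reasoning
  module S = ℤ.+-*-Solver

2/suc : ∀ k → + 2 / suc k ≡ + 1 / suc k + + 1 / suc k
2/suc k = toℚᵘ-injective (begin
  toℚᵘ (+ 2 / suc k)                             ≈⟨ toℚᵘ-/ (+ 2) k ⟩
  mkℚᵘ (+ 2) k                                   ≈⟨ *≡* (S.solve 1 (λ m → S.con (+ 2) S.:* (m S.:* m) S.:= (S.con (+ 1) S.:* m S.:+ S.con (+ 1) S.:* m) S.:* m) refl (+ suc k)) ⟩
  mkℚᵘ (+ 1) k ℚᵘ.+ mkℚᵘ (+ 1) k                 ≈⟨ ℚᵘ.+-cong (toℚᵘ-/ (+ 1) k) (toℚᵘ-/ (+ 1) k) ⟨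
  toℚᵘ (+ 1 / suc k) ℚᵘ.+ toℚᵘ (+ 1 / suc k)     ≈⟨ toℚᵘ-homo-+ (+ 1 / suc k) (+ 1 / suc k) ⟨
  toℚᵘ (+ 1 / suc k + + 1 / suc k)               ∎)
  where
  open ℚᵘ.≃-Reasoning
  module S = ℤ.+-*-Solver

1/suc-inverse : ∀ k → (+ 1 / suc k) * (+ suc k / 1) ≡ 1ℚ
1/suc-inverse k = toℚᵘ-injective (begin
  toℚᵘ ((+ 1 / suc k) * (+ suc k / 1))             ≈⟨ toℚᵘ-homo-* (+ 1 / suc k) (+ suc k / 1) ⟩
  toℚᵘ (+ 1 / suc k) ℚᵘ.* toℚᵘ (+ suc k / 1)       ≈⟨ ℚᵘ.*-cong (toℚᵘ-/ (+ 1) k) (toℚᵘ-/ (+ suc k) 0) ⟩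
  mkℚᵘ (+ 1) k ℚᵘ.* mkℚᵘ (+ suc k) 0               ≈⟨ *≡* (S.solve 1 (λ m → (S.con (+ 1) S.:* m) S.:* S.con (+ 1) S.:= S.con (+ 1) S.:* (m S.:* S.con (+ 1))) refl (+ suc k)) ⟩
  toℚᵘ 1ℚ                                          ∎)
  where
  open ℚᵘ.≃-Reasoning
  module S = ℤ.+-*-Solver

1/suc-nonneg : ∀ k → 0ℚ ≤ + 1 / suc k
1/suc-nonneg k = nonNegative⁻¹ (+ 1 / suc k) {{normalize-nonNeg 1 (suc k)}}

module _ {A : Set} where

  remove : ∀ {x : A} {xs} → x ∈ₗ xs → ∃ λ xs′ → length xs ≡ suc (length xs′)
    × (∀ f → sumOver xs f ≡ f x + sumOver xs′ f) × (∀ {y} → y ∈ₗ xs′ → y ∈ₗ xs)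
  remove {xs = x ∷ xs} (here refl) = xs , refl , (λ f → refl) , there
  remove {x} {xs = y ∷ xs} (there x∈) with remove x∈
  ... | xs′ , len , sums , sub = y ∷ xs′ , cong suc len ,
    (λ f → trans (cong (_+_ (f y)) (sums f))
      (solve 3 (λ a b c → a :+ (b :+ c) := b :+ (a :+ c)) refl (f y) (f x) (sumOver xs′ f))) ,
    λ { (here refl) → here refl ; (there y∈) → there (sub y∈) }

  split : ∀ m {l} (xs : List A) → length xs ≡ m ℕ.+ l → ∃ λ ys → ∃ λ zs → xs ≡ ys ++ zs × length ys ≡ m × length zs ≡ l
  split zero    xs       len = [] , xs , refl , refl , len
  split (suc m) (x ∷ xs) len with split m xs (ℕ.suc-injective len)
  ... | ys , zs , refl , eq , eq′ = x ∷ ys , zs , refl , cong suc eq , eq′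

  sum-pairs : ∀ (f g : A → ℚ) xs ys → length xs ≡ length ys → (∀ {x y} → x ∈ₗ xs → y ∈ₗ ys → 0ℚ ≤ f x + g y) →
    0ℚ ≤ sumOver xs f + sumOver ys g
  sum-pairs f g []       []       _   _     = ≤-refl
  sum-pairs f g (x ∷ xs) (y ∷ ys) len pairs = subst (0ℚ ≤_)
    (solve 4 (λ a b c e → (a :+ b) :+ (c :+ e) := (a :+ c) :+ (b :+ e)) refl (f x) (g y) (sumOver xs f) (sumOver ys g))
    (+-nonneg (pairs (here refl) (here refl)) (sum-pairs f g xs ys (ℕ.suc-injective len) (λ x∈ y∈ → pairs (there x∈) (there y∈))))

  sum-≥ : ∀ (g : A → ℚ) c m ys → m ≤ℕ length ys → (∀ y → 0ℚ ≤ g y) → (∀ {y} → y ∈ₗ ys → c ≤ g y) →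
    (+ m / 1) * c ≤ sumOver ys g
  sum-≥ g c zero    ys       _         g≥0 c≤ = ≤-trans (≤-reflexive (*-zeroˡ c)) (sum-nonneg ys (λ {y} _ → g≥0 y))
  sum-≥ g c (suc m) (y ∷ ys) (ℕ.s≤s m≤) g≥0 c≤ = begin
    (+ suc m / 1) * c           ≡⟨ cong (_* c) (suc/1 m) ⟩
    (1ℚ + + m / 1) * c          ≡⟨ solve 2 (λ a c → (con 1ℚ :+ a) :* c := c :+ a :* c) refl (+ m / 1) c ⟩
    c + (+ m / 1) * c           ≤⟨ +-mono-≤ (c≤ (here refl)) (sum-≥ g c m ys m≤ g≥0 (c≤ ∘ there)) ⟩
    g y + sumOver ys g          ∎
    where open ≤-Reasoning

  sum-bump : ∀ (g h : A → ℕ) {x} xs → Unique xs → x ∈ₗ xs → h x ≡ suc (g x) → (∀ {y} → y ≢ x → h y ≡ g y) →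
    sum (map h xs) ≡ suc (sum (map g xs))
  sum-bump g h (x ∷ xs) (x∉ ∷ _) (here refl) at-x off-x = cong₂ ℕ._+_ at-x (unchanged xs (λ y∈ y≡x → All¬⇒¬Any x∉ (subst (_∈ₗ xs) y≡x y∈)))
    where
    unchanged : ∀ ys → (∀ {y} → y ∈ₗ ys → y ≢ x) → sum (map h ys) ≡ sum (map g ys)
    unchanged []       _  = refl
    unchanged (y ∷ ys) ≢x = cong₂ ℕ._+_ (off-x (≢x (here refl))) (unchanged ys (≢x ∘ there))
  sum-bump g h (y ∷ xs) (y∉ ∷ uxs) (there x∈) at-x off-x = trans
    (cong₂ ℕ._+_ (off-x (λ { refl → All¬⇒¬Any y∉ x∈ })) (sum-bump g h xs uxs x∈ at-x off-x))
    (ℕ.+-suc (g y) (sum (map g xs)))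

-- Combining swaps along the fibres of η

module Exchange {n : ℕ} (F F* : Subset n) (η : Fin n → Fin n) (η∈ : ∀ x → η x ∈ F) (η-self : ∀ {f} → f ∈ F → η f ≡ f)
                (same-size : ∣ F ∣ ≡ ∣ F* ∣) where

  private
    V = Fin n

  fiber : V → List V
  fiber f = filter (λ x → η x Fin.≟ f) (members F*)

  ∈-fiber⁺ : ∀ {f x} → x ∈ F* → η x ≡ f → x ∈ₗ fiber f
  ∈-fiber⁺ {f} x∈ = ∈-filter⁺ (λ x → η x Fin.≟ f) (∈-members⁺ x∈)

  ∈-fiber⁻ : ∀ {f x} → x ∈ₗ fiber f → x ∈ F* × η x ≡ f
  ∈-fiber⁻ {f} x∈ with ∈-filter⁻ (λ x → η x Fin.≟ f) {xs = members F*} x∈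
  ... | x∈members , eq = ∈-members⁻ x∈members , eq

  fiber-unique : ∀ f → Unique (fiber f)
  fiber-unique f = filter⁺ (λ x → η x Fin.≟ f) (members-unique F*)

  Free : V → Set
  Free z = z ∈ F × fiber z ≡ []

  -- The fibres partition `F*`, which is as large as `F`. So the nonempty fibres have, in total, one
  -- surplus element for each free centre.
  sum-fiber-lengths : sum (map (length ∘ fiber) (members F)) ≡ length (members F)
  sum-fiber-lengths = trans (go (members F*))
    (trans (length-members F*) (trans (sym same-size) (sym (length-members F))))
    where
    part : List V → V → List V
    part xs f = filter (λ x → η x Fin.≟ f) xs
    go : ∀ xs → sum (map (length ∘ part xs) (members F)) ≡ length xs
    go []       = all-zero (members F)
      where
      all-zero : ∀ (fs : List V) → sum (map (length ∘ part []) fs) ≡ 0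
      all-zero []       = refl
      all-zero (_ ∷ fs) = all-zero fs
    go (x ∷ xs) = trans
      (sum-bump (length ∘ part xs) (length ∘ part (x ∷ xs)) (members F) (members-unique F) (∈-members⁺ (η∈ x))
        (cong length (filter-accept (λ y → η y Fin.≟ η x) {xs = xs} refl))
        (λ {f} f≢ → cong length (filter-reject (λ y → η y Fin.≟ f) {xs = xs} (λ ηx≡f → f≢ (sym ηx≡f)))))
      (cong suc (go xs))

  sum-fibers : ∀ (G : V → ℚ) → sumOver (members F) (λ f → sumOver (fiber f) G) ≡ sumOver (members F*) G
  sum-fibers G = begin
    sumOver (members F) (λ f → sumOver (fiber f) G)
      ≡⟨ sum-cong (members F) (λ {f} _ → sum-filter (λ x → η x Fin.≟ f) (members F*) G) ⟩
    sumOver (members F) (λ f → sumOver (members F*) (λ x → if-dec (η x Fin.≟ f) (G x)))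
      ≡⟨ sum-swap (members F) (members F*) (λ f x → if-dec (η x Fin.≟ f) (G x)) ⟩
    sumOver (members F*) (λ x → sumOver (members F) (λ f → if-dec (η x Fin.≟ f) (G x)))
      ≡⟨ sum-cong (members F*) (λ {x} _ → trans (if-point (members F) (members-unique F) (η x))
                                                (if-yes (η x ∈ₗ? members F) (∈-members⁺ (η∈ x)))) ⟩
    sumOver (members F*) G ∎
    where open ≡-Reasoning

  -- The last three hypotheses are the balances to be obtained from local optimality: charging a
  -- common centre as added, exchanging one new centre for a free one, and exchanging a whole fibre.
  -- Here `suc k` is the swap size t.
  module _ (G P : V → ℚ) (P≥0 : ∀ f → 0ℚ ≤ P f) (k : ℕ)
           (shared : ∀ {f} → f ∈ F → f ∈ F* → 0ℚ ≤ G f)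
           (single : ∀ {x z} → x ∈ F* → x ∉ F → Free z → 0ℚ ≤ G x + P z)
           (whole : ∀ {f zs} → f ∈ F → f ∉ F* → Unique (f ∷ zs) → (∀ {z} → z ∈ₗ zs → Free z) →
             length (f ∷ zs) ≡ length (fiber f) → length (f ∷ zs) ≤ℕ suc k →
             0ℚ ≤ sumOver (fiber f) G + sumOver (f ∷ zs) P) where

    private
      τ = + 1 / suc k

    inflate : ℚ → ℚ
    inflate x = x + τ * x

    τ*-nonneg : ∀ {x} → 0ℚ ≤ x → 0ℚ ≤ τ * x
    τ*-nonneg = *-nonneg (1/suc-nonneg k)

    inflate-≥ : ∀ {x} → 0ℚ ≤ x → x ≤ inflate x
    inflate-≥ 0≤x = a≤a+b (τ*-nonneg 0≤x)

    any-pair : ∀ {x z} → x ∈ F* → Free z → 0ℚ ≤ G x + P z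
    any-pair {x} {z} x∈ free with x ∈? F
    ... | yes x∈F = +-nonneg (shared x∈F x∈) (P≥0 z)
    ... | no x∉F  = single x∈ x∉F free

    sum-P-nonneg : ∀ zs → 0ℚ ≤ sumOver zs P
    sum-P-nonneg zs = sum-nonneg zs (λ {z} _ → P≥0 z)

    -- If `f` is common it cancels from its own fibre and the rest is paired with `zs`. If the group
    -- fits into one swap, `whole` applies. Otherwise `f` stays, so its penalty is pure slack; `bs`
    -- is paired with `zs`, and the leftover `b` costs each free centre at most a further τ. The
    -- failed size test also counts `f`, which leaves at least `suc k` elements in `zs`.
    group : ∀ {f b bs zs} → f ∈ F → fiber f ≡ b ∷ bs → length zs ≡ length bs → Unique (f ∷ zs) → (∀ {z} → z ∈ₗ zs → Free z) →
      0ℚ ≤ sumOver (fiber f) G + inflate (sumOver (f ∷ zs) P)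
    group {f} {b} {bs} {zs} f∈ fiber≡ len u free with f ∈? F*
    ... | yes f∈* with remove (∈-fiber⁺ f∈* (η-self f∈))
    ...   | L , lenL , sums , L⊆ = ≤-trans (+-nonneg (shared f∈ f∈*) pairs) (begin
      G f + (sumOver L G + sumOver zs P)                          ≡⟨ +-assoc (G f) _ _ ⟨
      (G f + sumOver L G) + sumOver zs P                          ≡⟨ cong (_+ sumOver zs P) (sums G) ⟨
      sumOver (fiber f) G + sumOver zs P                          ≤⟨ +-monoʳ-≤ (sumOver (fiber f) G) (≤-trans (a≤b+a (P≥0 f)) (inflate-≥ (sum-P-nonneg (f ∷ zs)))) ⟩
      sumOver (fiber f) G + inflate (sumOver (f ∷ zs) P)          ∎)
      where
      open ≤-Reasoning
      pairs : 0ℚ ≤ sumOver L G + sumOver zs P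
      pairs = sum-pairs G P L zs (ℕ.suc-injective (trans (sym lenL) (trans (cong length fiber≡) (cong suc (sym len)))))
        (λ x∈ z∈ → any-pair (proj₁ (∈-fiber⁻ (L⊆ x∈))) (free z∈))
    group {f} {b} {bs} {zs} f∈ fiber≡ len u free | no f∉* with length (f ∷ zs) ℕ.≤? suc k
    ... | yes small = ≤-trans (whole f∈ f∉* u free (trans (cong suc len) (sym (cong length fiber≡))) small)
      (+-monoʳ-≤ (sumOver (fiber f) G) (inflate-≥ (sum-P-nonneg (f ∷ zs))))
    ... | no large = subst (λ L → 0ℚ ≤ sumOver L G + inflate (sumOver (f ∷ zs) P)) (sym fiber≡)
      (≤-by-excess (+-mono-≤ (+-mono-≤ pairs spread) (+-mono-≤ (P≥0 f) (τ*-nonneg (P≥0 f))))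
        (solve 5 (λ Gb Gbs Pzs Pf τ →
            con 0ℚ :+ (((Gbs :+ Pzs) :+ τ :* Pzs) :+ (Pf :+ τ :* Pf))
            := ((Gb :+ Gbs) :+ ((Pf :+ Pzs) :+ τ :* (Pf :+ Pzs))) :+ ((con 0ℚ :+ (:- Gb)) :+ (con 0ℚ :+ con 0ℚ)))
          refl (G b) (sumOver bs G) (sumOver zs P) (P f) τ))
      where
      open ≤-Reasoning
      in-fiber : ∀ {x} → x ∈ₗ b ∷ bs → x ∈ F*
      in-fiber x∈ = proj₁ (∈-fiber⁻ (subst (_ ∈ₗ_) (sym fiber≡) x∈))
      pairs : 0ℚ ≤ sumOver bs G + sumOver zs P
      pairs = sum-pairs G P bs zs (sym len) (λ x∈ z∈ → any-pair (in-fiber (there x∈)) (free z∈))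
      -- The remaining new centre b is swapped with each of the at least 1/τ vertices of zs in turn.
      spread : - G b ≤ τ * sumOver zs P
      spread = begin
        - G b                             ≡⟨ *-identityˡ (- G b) ⟨
        1ℚ * - G b                        ≡⟨ cong (_* - G b) (1/suc-inverse k) ⟨
        (τ * (+ suc k / 1)) * - G b       ≡⟨ *-assoc τ (+ suc k / 1) (- G b) ⟩
        τ * ((+ suc k / 1) * - G b)       ≤⟨ *-monoˡ-≤-nonNeg τ {{nonNegative (1/suc-nonneg k)}}
                                               (sum-≥ P (- G b) (suc k) zs (ℕ.≤-pred (ℕ.≰⇒> large)) P≥0
                                                 (λ {z} z∈ → ≤-by-excess (any-pair (in-fiber (here refl)) (free z∈))
                                                   (solve 2 (λ g p → :- g :+ (g :+ p) := p :+ con 0ℚ) refl (G b) (P z)))) ⟩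
        τ * sumOver zs P                  ∎

    length≤sum : ∀ fs → (∀ {f} → f ∈ₗ fs → fiber f ≢ []) → length fs ≤ℕ sum (map (length ∘ fiber) fs)
    length≤sum []       _        = ℕ.z≤n
    length≤sum (f ∷ fs) nonempty with fiber f in eq
    ... | []    = contradiction eq (nonempty (here refl))
    ... | _ ∷ b = ℕ.s≤s (ℕ.≤-trans (length≤sum fs (nonempty ∘ there)) (ℕ.m≤n+m _ (length b)))

    -- The length equation keeps the stock `zs` equal to the surplus of the fibres still to be
    -- served, so every `f` can draw exactly the free centres that `group` asks for.
    deal : ∀ fs zs → (∀ {f} → f ∈ₗ fs → f ∈ F × fiber f ≢ []) → Unique zs → (∀ {z} → z ∈ₗ zs → Free z) →
      sum (map (length ∘ fiber) fs) ≡ length fs ℕ.+ length zs →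
      0ℚ ≤ sumOver fs (λ f → sumOver (fiber f) G) + inflate (sumOver fs P + sumOver zs P)
    deal []       zs _    _  _    _     = +-nonneg ≤-refl (≤-trans P-zs (inflate-≥ P-zs))
      where
      P-zs : 0ℚ ≤ 0ℚ + sumOver zs P
      P-zs = +-nonneg ≤-refl (sum-P-nonneg zs)
    deal (f ∷ fs) zs used uz free total with fiber f in eq
    ... | []     = contradiction eq (proj₂ (used (here refl)))
    ... | b ∷ bs = deal-out (split (length bs) zs length-zs)
      where
      R = sum (map (length ∘ fiber) fs)
      -- The surplus of the remaining fibres. The truncated subtraction is exact because each of
      -- them is nonempty.
      l = R ∸ length fs
      R≡ : R ≡ length fs ℕ.+ l
      R≡ = sym (ℕ.m+[n∸m]≡n (length≤sum fs (λ f∈ → proj₂ (used (there f∈)))))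
      length-zs : length zs ≡ length bs ℕ.+ l
      length-zs = ℕ.+-cancelˡ-≡ (length fs) (length zs) (length bs ℕ.+ l) (begin
        length fs ℕ.+ length zs            ≡⟨ ℕ.suc-injective total ⟨
        length bs ℕ.+ R                    ≡⟨ cong (length bs ℕ.+_) R≡ ⟩
        length bs ℕ.+ (length fs ℕ.+ l)    ≡⟨ ℕ.+-assoc (length bs) (length fs) l ⟨
        (length bs ℕ.+ length fs) ℕ.+ l    ≡⟨ cong (ℕ._+ l) (ℕ.+-comm (length bs) (length fs)) ⟩
        (length fs ℕ.+ length bs) ℕ.+ l    ≡⟨ ℕ.+-assoc (length fs) (length bs) l ⟩
        length fs ℕ.+ (length bs ℕ.+ l)    ∎)
        where open ≡-Reasoning
      deal-out : (∃ λ ys → ∃ λ zs′ → zs ≡ ys ++ zs′ × length ys ≡ length bs × length zs′ ≡ l) →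
        0ℚ ≤ (sumOver (b ∷ bs) G + sumOver fs (λ f → sumOver (fiber f) G)) + inflate ((P f + sumOver fs P) + sumOver zs P)
      deal-out (ys , zs′ , refl , len , len′) = subst (0ℚ ≤_) regroup (+-nonneg
        (subst (λ L → 0ℚ ≤ sumOver L G + inflate (sumOver (f ∷ ys) P)) eq
          (group (proj₁ (used (here refl))) eq len
            (All.tabulate (λ { y∈ refl → proj₂ (used (here refl)) (proj₂ (free (∈-++⁺ˡ y∈))) }) ∷ unique-++ˡ ys uz)
            (free ∘ ∈-++⁺ˡ)))
        (deal fs zs′ (used ∘ there) (unique-++ʳ ys uz) (free ∘ ∈-++⁺ʳ ys) (trans R≡ (cong (length fs ℕ.+_) (sym len′)))))
        where
        unique-++ˡ : ∀ xs {ys : List V} → Unique (xs ++ ys) → Unique xs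
        unique-++ˡ []       _          = []
        unique-++ˡ (x ∷ xs) (x∉ ∷ uxs) = All.tabulate (λ y∈ → All.lookup x∉ (∈-++⁺ˡ y∈)) ∷ unique-++ˡ xs uxs
        unique-++ʳ : ∀ xs {ys : List V} → Unique (xs ++ ys) → Unique ys
        unique-++ʳ []       uys       = uys
        unique-++ʳ (x ∷ xs) (_ ∷ uxs) = unique-++ʳ xs uxs
        Gs = sumOver fs (λ f → sumOver (fiber f) G)
        regroup : (sumOver (b ∷ bs) G + inflate (P f + sumOver ys P)) + (Gs + inflate (sumOver fs P + sumOver zs′ P))
          ≡ (sumOver (b ∷ bs) G + Gs) + inflate ((P f + sumOver fs P) + sumOver (ys ++ zs′) P)
        regroup = trans
          (solve 7 (λ g h a b c e τ →
              (g :+ ((a :+ b) :+ τ :* (a :+ b))) :+ (h :+ ((c :+ e) :+ τ :* (c :+ e)))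
              := (g :+ h) :+ (((a :+ c) :+ (b :+ e)) :+ τ :* ((a :+ c) :+ (b :+ e))))
            refl (sumOver (b ∷ bs) G) Gs (P f) (sumOver ys P) (sumOver fs P) (sumOver zs′ P) τ)
          (cong (λ x → (sumOver (b ∷ bs) G + Gs) + inflate ((P f + sumOver fs P) + x)) (sym (sum-++ ys zs′ P)))

    record Sorted (fs : List V) : Set where
      field
        used free : List V
        used-∈    : ∀ {f} → f ∈ₗ used → f ∈ₗ fs × fiber f ≢ []
        free-∈    : ∀ {z} → z ∈ₗ free → z ∈ₗ fs × fiber z ≡ []
        unique    : Unique free
        lengths   : length fs ≡ length used ℕ.+ length free
        fibers    : sum (map (length ∘ fiber) fs) ≡ sum (map (length ∘ fiber) used)
        gains     : sumOver fs (λ f → sumOver (fiber f) G) ≡ sumOver used (λ f → sumOver (fiber f) G)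
        penalties : sumOver fs P ≡ sumOver used P + sumOver free P

    sort : ∀ fs → Unique fs → Sorted fs
    sort []       _ = record
      { used = [] ; free = [] ; used-∈ = λ () ; free-∈ = λ () ; unique = [] ; lengths = refl
      ; fibers = refl ; gains = refl ; penalties = refl }
    sort (f ∷ fs) (f∉ ∷ ufs) = place (fiber f) refl
      where
      open Sorted (sort fs ufs)
      place : ∀ L → fiber f ≡ L → Sorted (f ∷ fs)
      place []      eq = record
        { used      = used
        ; free      = f ∷ free
        ; used-∈    = λ f∈ → there (proj₁ (used-∈ f∈)) , proj₂ (used-∈ f∈)
        ; free-∈    = λ { (here refl) → here refl , eq ; (there z∈) → there (proj₁ (free-∈ z∈)) , proj₂ (free-∈ z∈) }
        ; unique    = All.tabulate (λ { z∈ refl → All¬⇒¬Any f∉ (proj₁ (free-∈ z∈)) }) ∷ unique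
        ; lengths   = trans (cong suc lengths) (sym (ℕ.+-suc (length used) (length free)))
        ; fibers    = trans (cong (λ L → length L ℕ.+ sum (map (length ∘ fiber) fs)) eq) fibers
        ; gains     = trans (cong (λ L → sumOver L G + sumOver fs (λ f → sumOver (fiber f) G)) eq) (trans (+-identityˡ _) gains)
        ; penalties = trans (cong (_+_ (P f)) penalties)
            (solve 3 (λ a b c → a :+ (b :+ c) := b :+ (a :+ c)) refl (P f) (sumOver used P) (sumOver free P))
        }
      place (b ∷ bs) eq = record
        { used      = f ∷ used
        ; free      = free
        ; used-∈    = λ { (here refl) → here refl , (λ eq′ → case trans (sym eq) eq′ of λ ()) ; (there f∈) → there (proj₁ (used-∈ f∈)) , proj₂ (used-∈ f∈) }
        ; free-∈    = λ z∈ → there (proj₁ (free-∈ z∈)) , proj₂ (free-∈ z∈)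
        ; unique    = unique
        ; lengths   = cong suc lengths
        ; fibers    = cong (length (fiber f) ℕ.+_) fibers
        ; gains     = cong (_+_ (sumOver (fiber f) G)) gains
        ; penalties = trans (cong (_+_ (P f)) penalties) (sym (+-assoc (P f) (sumOver used P) (sumOver free P)))
        }

    exchange : 0ℚ ≤ sumOver (members F*) G + inflate (sumOver (members F) P)
    exchange = subst₂ (λ x y → 0ℚ ≤ x + inflate y) (trans (sym gains) (sum-fibers G)) (sym penalties)
      (deal used free (λ f∈ → ∈-members⁻ (proj₁ (used-∈ f∈)) , proj₂ (used-∈ f∈)) unique
        (λ z∈ → ∈-members⁻ (proj₁ (free-∈ z∈)) , proj₂ (free-∈ z∈))
        (trans (sym fibers) (trans sum-fiber-lengths lengths)))
      where open Sorted (sort (members F) (members-unique F))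

-- Turning lists back into subsets

module _ {n : ℕ} where

  private
    V = Fin n

  toSubset : List V → Subset n
  toSubset L = Vec.tabulate (λ u → does (u ∈ₗ? L))

  ∈-toSubset⁺ : ∀ {L u} → u ∈ₗ L → u ∈ toSubset L
  ∈-toSubset⁺ {L} {u} u∈ = lookup⇒[]= u (toSubset L)
    (trans (lookup∘tabulate (λ v → does (v ∈ₗ? L)) u) (dec-true (u ∈ₗ? L) u∈))

  ∈-toSubset⁻ : ∀ {L u} → u ∈ toSubset L → u ∈ₗ L
  ∈-toSubset⁻ {L} {u} u∈ with u ∈ₗ? L | trans (sym (lookup∘tabulate (λ v → does (v ∈ₗ? L)) u)) ([]=⇒lookup u∈)
  ... | yes u∈L | _  = u∈L
  ... | no _    | ()

  ∣toSubset∣ : ∀ {L} → Unique L → ∣ toSubset L ∣ ≡ length L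
  ∣toSubset∣ {L} uL = trans (sym (length-members (toSubset L))) (↭-length (∼bag⇒↭
    (unique∧set⇒bag (members-unique (toSubset L)) uL (mk⇔ (∈-toSubset⁻ ∘ ∈-members⁻) (∈-members⁺ ∘ ∈-toSubset⁺)))))

  nonempty : ∀ (S : Subset n) → 1 ≤ℕ ∣ S ∣ → ∃ (_∈ S)
  nonempty S 1≤ with members S in eq | subst (1 ≤ℕ_) (sym (length-members S)) 1≤
  ... | []    | ()
  ... | s ∷ _ | _ = s , ∈-members⁻ (subst (s ∈ₗ_) (sym eq) (here refl))

-- Local optimality and the final bound

module LocalOptimum {n : ℕ} {d : Fin n → Fin n → ℚ} (metric : IsMetric d)
  {q : Fin n → ℚ} (q≥0 : ∀ u → 0ℚ ≤ q u) (k : ℕ)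
  {F : Subset n} (ne : ∃ (_∈ F)) {φF : ℚ} (isΦ : IsPhi d q F φF)
  (local : ∀ (D A : Subset n) → D ⊆ F → A ⊆ ∁ F → ∣ D ∣ ≡ ∣ A ∣ → ∣ D ∣ ≤ℕ suc k →
    ∀ φ′ → IsPhi d q ((F ∩ ∁ D) ∪ A) φ′ → ¬ (φ′ < φF))
  {F* : Subset n} (ne* : ∃ (_∈ F*)) {φF* : ℚ} (isΦ* : IsPhi d q F* φF*) (same-size : ∣ F ∣ ≡ ∣ F* ∣) where

  private
    V = Fin n
    open IsMetric metric using (nonneg; refl0; zero-iff)

    m m* : ℚ
    m  = proj₁ isΦ
    m* = proj₁ isΦ*

    optimal-forest : ∀ {S μ} → ∃ (_∈ S) → IsMSTWeight d S μ →
      ∃ λ es → Grown S es × (∀ u → Covered S es u) × edgeWeight d es ≤ μ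
    optimal-forest ne ((T , span , refl) , _) = grow-within metric ne (IsSpanningTreeContr.connected span)

    forest  = optimal-forest ne (proj₁ (proj₂ isΦ))
    forest* = optimal-forest ne* (proj₁ (proj₂ isΦ*))
    es      = proj₁ forest
    es*     = proj₁ forest*
    grown   = proj₁ (proj₂ forest)
    grown*  = proj₁ (proj₂ forest*)
    spans   = proj₁ (proj₂ (proj₂ forest))
    spans*  = proj₁ (proj₂ (proj₂ forest*))
    es≤m    = proj₂ (proj₂ (proj₂ forest))
    es*≤m*  = proj₂ (proj₂ (proj₂ forest*))

    module Service = ServiceSwap metric q q≥0 F F* ne ne*

    η : V → V
    η = Service.s

    -- The nearest centre to `f` is at distance 0, and distinct points of a metric are not.
    η-self : ∀ {f} → f ∈ F → η f ≡ f
    η-self {f} f∈ = sym (zero-iff f (η f)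
      (≤-antisym (subst (d f (η f) ≤_) (refl0 f) (Service.s-least f f∈)) (nonneg f (η f))))

    module Forest = ForestSwap metric F F* η Service.s∈ Service.s-least grown spans grown* spans*
    module Ex = Exchange F F* η Service.s∈ η-self same-size

    G P : V → ℚ
    G x = Service.gain x + Forest.gain x
    P f = Service.penalty f + Forest.penalty f

    P≥0 : ∀ f → 0ℚ ≤ P f
    P≥0 f = +-nonneg (Service.penalty-nonneg f) (Forest.penalty-nonneg f)

    C C* L L* : ℚ
    C  = sumOver allV Service.c
    C* = sumOver allV Service.c*
    L  = sumOver allV (linkCost metric F (parent F es))
    L* = sumOver allV (linkCost metric F* (parent F* es*))

    L≤m : L ≤ m
    L≤m = ≤-trans (sum-linkCost metric F es (allFin⁺ n)) es≤m

    L*≤m* : L* ≤ m*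
    L*≤m* = ≤-trans (sum-linkCost metric F* es* (allFin⁺ n)) es*≤m*

    m≤L : m ≤ L
    m≤L = mst≤forest metric (proj₁ (proj₂ isΦ)) (λ u → parent-reach F grown (spans u))

    -- The swap (D , A) may involve common centres; D′ and A′ are what is really deleted and added.
    swap-balance : ∀ {D A D′ A′} → Unique D → Unique A → Unique D′ → Unique A′ →
      (∀ {u} → u ∈ₗ D′ → u ∈ F) → (∀ {u} → u ∈ₗ A′ → u ∉ F) → length D′ ≡ length A′ → length D′ ≤ℕ suc k →
      (∀ {u} → u ∈ₗ D′ → u ∈ₗ D) → (∀ {u} → u ∈ₗ D′ → u ∉ₗ A) → (∀ {u} → u ∈ₗ A → u ∈ₗ A′ ⊎ u ∈ F) →
      (∀ {x} → x ∈ F* → η x ∈ₗ D → x ∈ₗ A) → 0ℚ ≤ sumOver A G + sumOver D P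
    swap-balance {D} {A} {D′} {A′} uD uA uD′ uA′ D′⊆F A′∩F len len≤ D′⊆D D′∩A A⊆ closed =
      -- The goal is decidable and may be refuted twice, which releases a minimum tree of the
      -- swapped set. The rerouted forest supplies the spanning tree that its existence requires. A
      -- negative `X` would then make the swap an improvement.
      decidable-stable (0ℚ ≤? X) λ X≱0 → ¬¬-mst d (links-spanning metric (Forest.reroute-reach valid)) λ (μ , mst) →
        local (toSubset D′) (toSubset A′) (D′⊆F ∘ ∈-toSubset⁻) (λ u∈ → x∉p⇒x∈∁p (A′∩F (∈-toSubset⁻ u∈)))
          (trans (∣toSubset∣ uD′) (trans len (sym (∣toSubset∣ uA′))))
          (subst (_≤ℕ suc k) (sym (∣toSubset∣ uD′)) len≤)
          (serviceCost d q S + μ) (μ , mst , refl)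
          (≤-<-trans (bound mst) (subst₂ _<_ refl (trans (+-identityʳ _) (sym (proj₂ (proj₂ isΦ))))
            (+-monoʳ-< (serviceCost d q F + m) (≰⇒> X≱0))))
      where
      X = sumOver A G + sumOver D P
      S = (F ∩ ∁ (toSubset D′)) ∪ toSubset A′
      stays : ∀ {u} → u ∈ F → u ∉ₗ D′ → u ∈ S
      stays u∈ u∉ = x∈p∪q⁺ (inj₁ (x∈p∩q⁺ (u∈ , x∉p⇒x∈∁p (u∉ ∘ ∈-toSubset⁻))))
      valid : ValidSwap F F* η D A S
      valid = record
        { keeps  = λ u∈ u∉ → stays u∈ (u∉ ∘ D′⊆D)
        ; adds   = λ x∈ → case A⊆ x∈ of λ where
            (inj₁ x∈A′) → x∈p∪q⁺ {p = F ∩ ∁ (toSubset D′)} (inj₂ (∈-toSubset⁺ x∈A′))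
            (inj₂ x∈F)  → stays x∈F (λ x∈D′ → D′∩A x∈D′ x∈)
        ; closed = closed
        }
      bound : ∀ {μ} → IsMSTWeight d S μ → serviceCost d q S + μ ≤ (serviceCost d q F + m) + X
      bound {μ} mst = begin
        serviceCost d q S + μ
          ≤⟨ +-mono-≤ (sum-mono allV (λ {u} _ → Service.service-cost valid u))
                      (≤-trans (mst≤forest metric mst (Forest.reroute-reach valid))
                               (sum-mono allV (λ {u} _ → Forest.reroute-cost valid u))) ⟩
        sumOver allV (Service.afterSwap D A) + sumOver allV (Forest.afterSwap D A)
          ≡⟨ cong₂ _+_ (Service.sum-afterSwap uD uA) (Forest.sum-afterSwap uD uA) ⟩
        (C + (g₁ + p₁)) + (L + (g₂ + p₂))
          ≤⟨ +-monoʳ-≤ (C + (g₁ + p₁)) (+-monoˡ-≤ (g₂ + p₂) L≤m) ⟩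
        (C + (g₁ + p₁)) + (m + (g₂ + p₂))
          ≡⟨ solve 6 (λ c l g p g′ p′ → (c :+ (g :+ p)) :+ (l :+ (g′ :+ p′)) := (c :+ l) :+ ((g :+ g′) :+ (p :+ p′)))
               refl C m g₁ p₁ g₂ p₂ ⟩
        (C + m) + ((g₁ + g₂) + (p₁ + p₂))
          ≡⟨ cong₂ (λ x y → (C + m) + (x + y)) (sum-+ A Service.gain Forest.gain) (sum-+ D Service.penalty Forest.penalty) ⟨
        (serviceCost d q F + m) + X ∎
        where
        open ≤-Reasoning
        g₁ = sumOver A Service.gain
        g₂ = sumOver A Forest.gain
        p₁ = sumOver D Service.penalty
        p₂ = sumOver D Forest.penalty

    no-free : ∀ {x z} → x ∈ F* → η x ≡ z → ¬ Ex.Free z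
    no-free x∈ ηx≡z (_ , none) = case subst (_ ∈ₗ_) none (Ex.∈-fiber⁺ x∈ ηx≡z) of λ ()

    -- The empty swap suffices: since `f` is already open, moving its optimal clients and its
    -- component of T* to it cannot beat the present assignment and minimum tree.
    shared : ∀ {f} → f ∈ F → f ∈ F* → 0ℚ ≤ G f
    shared {f} f∈ _ = subst (0ℚ ≤_) (trans (+-identityʳ _) (+-identityʳ (G f)))
      (swap-balance {[]} {f ∷ []} {[]} {[]} [] ([] ∷ []) [] [] (λ ()) (λ ()) refl ℕ.z≤n (λ ()) (λ ())
        (λ { (here refl) → inj₂ f∈ }) (λ _ ()))

    single : ∀ {x z} → x ∈ F* → x ∉ F → Ex.Free z → 0ℚ ≤ G x + P z
    single {x} {z} x∈ x∉F free = subst (0ℚ ≤_) (cong₂ _+_ (+-identityʳ (G x)) (+-identityʳ (P z)))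
      (swap-balance {z ∷ []} {x ∷ []} ([] ∷ []) ([] ∷ []) ([] ∷ []) ([] ∷ [])
        (λ { (here refl) → proj₁ free }) (λ { (here refl) → x∉F }) refl (ℕ.s≤s ℕ.z≤n) id
        (λ { (here refl) (here refl) → x∉F (proj₁ free) }) inj₁
        (λ { y∈ (here ηy≡z) → contradiction free (no-free y∈ ηy≡z) }))

    whole : ∀ {f zs} → f ∈ F → f ∉ F* → Unique (f ∷ zs) → (∀ {z} → z ∈ₗ zs → Ex.Free z) →
      length (f ∷ zs) ≡ length (Ex.fiber f) → length (f ∷ zs) ≤ℕ suc k →
      0ℚ ≤ sumOver (Ex.fiber f) G + sumOver (f ∷ zs) P
    whole {f} {zs} f∈ f∉* u free len len≤ =
      swap-balance u (Ex.fiber-unique f) u (Ex.fiber-unique f) D⊆F fiber∩F len len≤ id (λ u∈D u∈A → fiber∩F u∈A (D⊆F u∈D)) inj₁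
        (λ { x∈ (here ηx≡f) → Ex.∈-fiber⁺ x∈ ηx≡f ; x∈ (there ηx∈) → contradiction (free ηx∈) (no-free x∈ refl) })
      where
      D⊆F : ∀ {u} → u ∈ₗ f ∷ zs → u ∈ F
      D⊆F (here refl) = f∈
      D⊆F (there u∈)  = proj₁ (free u∈)
      -- A member of `F` in this fibre is its own nearest centre, hence equal to `f`, which is not
      -- in `F*`.
      fiber∩F : ∀ {x} → x ∈ₗ Ex.fiber f → x ∉ F
      fiber∩F x∈ x∈F with Ex.∈-fiber⁻ x∈
      ... | x∈* , ηx≡f = f∉* (subst (_∈ F*) (trans (sym (η-self x∈F)) ηx≡f) x∈*)

  approximation : φF ≤ ((+ 3 / 1) + (+ 2 / suc k)) * φF*
  approximation = subst₂ _≤_ (sym (proj₂ (proj₂ isΦ)))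
    (cong₂ (λ x y → ((+ 3 / 1) + x) * y) (sym (2/suc k)) (sym (proj₂ (proj₂ isΦ*))))
    (≤-by-excess
      -- The optimum enters once through the gains and 2(1 + τ) times through the penalties, giving
      -- 3 + 2τ with τ = 1/t. The last two inequalities replace the rooted edge costs by the tree
      -- weights.
      (+-mono-≤ balance (+-mono-≤ (+-mono-≤ P≤ (*-monoˡ-≤-nonNeg τ {{nonNegative (1/suc-nonneg k)}} P≤)) (+-mono-≤ m≤L L*≤m*)))
      (solve 8 (λ c c* l l* m m* p τ →
          (c :+ m) :+ ((((c* :- c) :+ (l* :- l)) :+ (p :+ τ :* p)) :+
            ((((c* :+ c*) :+ (m* :+ m*)) :+ τ :* ((c* :+ c*) :+ (m* :+ m*))) :+ (l :+ m*)))
          := (con (+ 3 / 1) :+ (τ :+ τ)) :* (c* :+ m*) :+ (con 0ℚ :+ ((p :+ τ :* p) :+ (m :+ l*))))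
        refl C C* L L* m m* ΣP τ))
    where
    open ≤-Reasoning
    τ = + 1 / suc k
    ΣP = sumOver (members F) P
    balance : 0ℚ ≤ ((C* - C) + (L* - L)) + (ΣP + τ * ΣP)
    balance = subst (λ x → 0ℚ ≤ x + (ΣP + τ * ΣP))
      (trans (sum-+ (members F*) Service.gain Forest.gain) (cong₂ _+_ (Service.sum-gain F* Service.o∈) (Forest.sum-gain F* Forest.o∈)))
      (Ex.exchange G P P≥0 k shared single whole)
    P≤ : ΣP ≤ (C* + C*) + (m* + m*)
    P≤ = begin
      ΣP
        ≡⟨ sum-+ (members F) Service.penalty Forest.penalty ⟩
      sumOver (members F) Service.penalty + sumOver (members F) Forest.penalty
        ≤⟨ +-mono-≤ (Service.sum-penalty F) (Forest.sum-penalty F) ⟩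
      sumOver allV Service.pen + sumOver allV Forest.patchCost
        ≤⟨ +-mono-≤ (≤-reflexive (sum-+ allV Service.c* Service.c*))
                    (≤-trans Forest.sum-patchCost (+-mono-≤ es*≤m* es*≤m*)) ⟩
      (C* + C*) + (m* + m*) ∎

theorem6 : (n : ℕ) (d : Fin n → Fin n → ℚ) → IsMetric d →
    (q : Fin n → ℚ) → (∀ u → 0ℚ ≤ q u) →
    (k : ℕ) → 1 ≤ℕ k → k ≤ℕ n →
    (t : ℕ) → .{{_ : NonZero t}} →
    (F : Subset n) → ∣ F ∣ ≡ k →
    (φF : ℚ) → IsPhi d q F φF →
    (∀ (D A : Subset n) → D ⊆ F → A ⊆ ∁ F → ∣ D ∣ ≡ ∣ A ∣ → ∣ D ∣ ≤ℕ t →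
    ∀ φ' → IsPhi d q ((F ∩ ∁ D) ∪ A) φ' → ¬ (φ' < φF)) →
    (F* : Subset n) → ∣ F* ∣ ≡ k →
    (φF* : ℚ) → IsPhi d q F* φF* →
    φF ≤ ((+ 3 / 1) + (+ 2 / t)) * φF*
theorem6 n d metric q q≥0 k 1≤k _ (suc t) F ∣F∣≡k φF isΦ local F* ∣F*∣≡k φF* isΦ* =
  -- After matching on `suc t`, the variable `t` is the swap size minus one. It instantiates the `k`
  -- of `LocalOptimum`, which is thus not the number of centres.
  LocalOptimum.approximation metric q≥0 t
    (nonempty F (subst (1 ≤ℕ_) (sym ∣F∣≡k) 1≤k)) isΦ local
    (nonempty F* (subst (1 ≤ℕ_) (sym ∣F*∣≡k) 1≤k)) isΦ* (trans ∣F∣≡k (sym ∣F*∣≡k))
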